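{- For every fixed integer $k\ge 4$, there are infinitely many $k$-critical graphs in which every cycle has at most a constant number of chords, the constant depending only on $k$. More precisely, for every $k\ge4$ and every $m\ge 1$, the graph $H_{k,m}$ (defined in the context) is $k$-critical, has $(25k-80)m+26k-73$ vertices, and each of its cycles has at most $$\binom{k-3}{2}+10(k-3)^2+60(k-3)$$ chords.
   Context: All graphs are finite and simple. A graph $G$ is $k$-critical if $\chi(G)=k$ and every proper subgraph of $G$ is $(k-1)$-colorable. A chord of a cycle $C$ in $G$ is an edge of $G$ joining two vertices of $C$ that are not consecutive on $C$. Construction of $H_{k,m}$. Let $k\ge4$, $m\ge1$ and $p=k-3$. Let $Q=\{q_1,\ldots,q_p\}$ be a clique. For each $i\in\{0,\ldots,m\}$ take a pentagon ($5$-cycle) $S_i=a_ib_ic_id_it_ia_i$ (all these vertices being distinct and disjoint from $Q$), and add the edges $c_ia_{i+1}$ for $0\le i<m$. For a vertex $x$ of some $S_i$ and $j\in\{1,\ldots,p\}$, "attaching the leaf $L_j(x)$" means: add five new vertices $r,u,v,w,z$ forming a pentagon $ruvwzr$, add the edge $xr$, add all edges from each of $u,v,w,z$ to all vertices of $Q$, and add all edges from $r$ to $Q\setminus\{q_j\}$ (no other edges involve these new vertices). Attach the following leaves, each with its own new vertices: for every $0\le i\le m$ and every $1\le j\le p$, the leaves $L_j(b_i),L_j(d_i),L_j(t_i)$; for every $1\le j\le p$, the leaves $L_j(a_0)$ and $L_j(c_m)$; for $1\le i\le m$ and $2\le j\le p$, the leaf $L_j(a_i)$; for $0\le i<m$ and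 $2\le j\le p$, the leaf $L_j(c_i)$. The resulting graph is $H_{k,m}$. -}

module Defs where

open import Data.Bool using (Bool; T)
open import Data.Empty using (⊥)
open import Data.Fin using (Fin; zero; suc; toℕ; fromℕ; inject₁; _≟_)
open import Data.Fin.Properties using (+↔⊎; *↔×) renaming (_<?_ to _<ᶠ?_)
open import Data.Fin.Patterns using (0F; 1F; 2F; 3F; 4F)
open import Data.List using (length; filter; allFin; cartesianProduct)
open import Data.Nat using (ℕ; zero; suc; _+_; _*_; _∸_; _≤_; _<_)
open import Data.Nat.Properties using (1+n≢n) renaming (_≟_ to _≟ℕ_)
open import Data.Product using (Σ-syntax; ∃-syntax; _×_; _,_; proj₁)
open import Data.Product.Function.NonDependent.Propositional using (_×-↔_)
open import Data.Product.Properties using (≡-dec)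
open import Data.Sum using (_⊎_; inj₁; inj₂; swap; [_,_]′)
open import Data.Sum.Function.Propositional using (_⊎-↔_)
open import Function using (id)
open import Function.Bundles using (_↔_; _⇔_; mk↔ₛ′; module Inverse)
open import Function.Properties.Inverse using (↔-refl; ↔-sym; ↔-trans; ↔⇒↣)
open import Level using (0ℓ)
open import Relation.Binary.Core using (Rel)
open import Relation.Binary.Definitions using (Decidable; DecidableEquality; Symmetric; Irreflexive)
open import Relation.Binary.PropositionalEquality using (_≡_; _≢_; refl; sym)
open import Relation.Nullary using (¬_; no; ¬?; _×-dec_; _⊎-dec_)
open import Relation.Nullary.Decidable using (via-injection)
import Relation.Unary as U

Finite : Set → Set
Finite A = Σ[ n ∈ ℕ ] (A ↔ Fin n)

finite-Fin : ∀ n → Finite (Fin n)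
finite-Fin n = n , ↔-refl

infixr 1 _⊎-finite_
infixr 2 _×-finite_

_⊎-finite_ : ∀ {A B} → Finite A → Finite B → Finite (A ⊎ B)
(m , f) ⊎-finite (n , g) = m + n , ↔-trans (f ⊎-↔ g) (↔-sym +↔⊎)

_×-finite_ : ∀ {A B} → Finite A → Finite B → Finite (A × B)
(m , f) ×-finite (n , g) = m * n , ↔-trans (f ×-↔ g) (↔-sym *↔×)

finite-↔ : ∀ {A B} → A ↔ B → Finite B → Finite A
finite-↔ e (n , f) = n , ↔-trans e f

finite⇒≟ : ∀ {A} → Finite A → DecidableEquality A
finite⇒≟ (_ , f) = via-injection (↔⇒↣ f) _≟_

record Graph : Set₁ where
  infix 4 _~_ _~?_
  field
    V        : Set
    finite   : Finite V
    _~_      : Rel V 0ℓ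
    _~?_     : Decidable _~_
    ~-sym    : Symmetric _~_
    ~-irrefl : Irreflexive _≡_ _~_

  order : ℕ
  order = proj₁ finite

open Graph public using (V; order)

infix 4 _≅_

_≅_ : Graph → Graph → Set
G ≅ H = Σ[ φ ∈ (V G ↔ V H) ]
  (∀ x y → Graph._~_ G x y ⇔ Graph._~_ H (Inverse.to φ x) (Inverse.to φ y))

-- Infinitely many up to isomorphism.
InfinitelyMany : (Graph → Set) → Set₁
InfinitelyMany P = Σ[ G ∈ (ℕ → Graph) ]
  (∀ i → P (G i)) × (∀ i j → i ≢ j → ¬ (G i ≅ G j))

Colourable : {A : Set} → Rel A 0ℓ → ℕ → Set
Colourable {A} _~_ n = Σ[ f ∈ (A → Fin n) ] (∀ {x y} → x ~ y → f x ≢ f y)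

-- ChromaticNumber G k says that χ(G) = k.
ChromaticNumber : Graph → ℕ → Set
ChromaticNumber G k = Colourable _~_ k × (∀ j → Colourable _~_ j → k ≤ j)
  where open Graph G

record Subgraph (G : Graph) : Set where
  open Graph G using (_~_)
  field
    inV     : V G → Bool
    inE     : V G → V G → Bool
    inE-sym : ∀ {x y} → T (inE x y) → T (inE y x)
    inE⇒~   : ∀ {x y} → T (inE x y) → x ~ y
    inE⇒inV : ∀ {x y} → T (inE x y) → T (inV x)

  Vertices : Set
  Vertices = Σ[ x ∈ V G ] T (inV x)

  Adjacent : Rel Vertices 0ℓ
  Adjacent (x , _) (y , _) = T (inE x y)

  Proper : Set
  Proper = (∃[ x ] ¬ T (inV x)) ⊎ (∃[ x ] ∃[ y ] (x ~ y × ¬ T (inE x y)))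

Critical : ℕ → Graph → Set
Critical k G = ChromaticNumber G k
  × (∀ (S : Subgraph G) → Subgraph.Proper S → Colourable (Subgraph.Adjacent S) (k ∸ 1))

-- j follows i in the cyclic order 0, 1, …, n-1, 0.
Follows : ∀ {n} → Fin n → Fin n → Set
Follows {n} i j = (toℕ j ≡ suc (toℕ i)) ⊎ (suc (toℕ i) ≡ n × toℕ j ≡ 0)

follows? : ∀ {n} → Decidable (Follows {n})
follows? {n} i j =
  (toℕ j ≟ℕ suc (toℕ i)) ⊎-dec ((suc (toℕ i) ≟ℕ n) ×-dec (toℕ j ≟ℕ 0))

Consecutive : ∀ {n} → Fin n → Fin n → Set
Consecutive i j = Follows i j ⊎ Follows j i

record Cycle (G : Graph) : Set where
  open Graph G using (_~_; _~?_)
  field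
    len       : ℕ
    3≤len     : 3 ≤ len
    at        : Fin len → V G
    injective : ∀ {i j} → at i ≡ at j → i ≡ j
    adjacent  : ∀ {i j} → Follows i j → at i ~ at j

  -- The unordered pair {at i , at j} is represented once, with i < j.
  Chord : U.Pred (Fin len × Fin len) 0ℓ
  Chord (i , j) = toℕ i < toℕ j × at i ~ at j × ¬ Consecutive i j

  chord? : U.Decidable Chord
  chord? (i , j) =
    (i <ᶠ? j) ×-dec (at i ~? at j) ×-dec ¬? (follows? i j ⊎-dec follows? j i)

  #chords : ℕ
  #chords = length (filter chord? (cartesianProduct (allFin len) (allFin len)))

-- The vertices of a pentagon in cyclic order.  A pentagon Sᵢ is a b c d t,
-- the pentagon of a leaf is r u v w z; only a, b, c, d, t and r need names.
Pentagon : Set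
Pentagon = Fin 5

pattern aᵢ = 0F
pattern bᵢ = 1F
pattern cᵢ = 2F
pattern dᵢ = 3F
pattern tᵢ = 4F

pattern root = 0F

next : Pentagon → Pentagon
next 0F = 1F
next 1F = 2F
next 2F = 3F
next 3F = 4F
next 4F = 0F

next-≢ : ∀ x → x ≢ next x
next-≢ 0F ()
next-≢ 1F ()
next-≢ 2F ()
next-≢ 3F ()
next-≢ 4F ()

-- The inclusion of {2, …, p} into {1, …, p}.
from2 : ∀ {p} → Fin (p ∸ 1) → Fin p
from2 {suc _} j = suc j

-- p is the size of the clique Q.  The index j ∈ {1, …, p} is shifted to
-- Fin p, so that j = 1 becomes zero.
module Construction (p m : ℕ) where

  data Leaf : Set where
    at-b at-d at-t : Fin (suc m) → Fin p → Leaf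
    at-a₀ at-cₘ    : Fin p → Leaf
    at-a at-c      : Fin m → Fin (p ∸ 1) → Leaf

  -- The leaf L is L_j(x) for x = base L and j = index L.
  base : Leaf → Fin (suc m) × Pentagon
  base (at-b i _) = i , bᵢ
  base (at-d i _) = i , dᵢ
  base (at-t i _) = i , tᵢ
  base (at-a₀ _)  = zero , aᵢ
  base (at-cₘ _)  = fromℕ m , cᵢ
  base (at-a i _) = suc i , aᵢ
  base (at-c i _) = inject₁ i , cᵢ

  index : Leaf → Fin p
  index (at-b _ j) = j
  index (at-d _ j) = j
  index (at-t _ j) = j
  index (at-a₀ j)  = j
  index (at-cₘ j)  = j
  index (at-a _ j) = from2 j
  index (at-c _ j) = from2 j

  data Vertex : Set where
    q : Fin p → Vertex
    s : Fin (suc m) → Pentagon → Vertex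
    ℓ : Leaf → Pentagon → Vertex

  finite-Leaf : Finite Leaf
  finite-Leaf = finite-↔ (mk↔ₛ′ to from to∘from from∘to)
    (B ⊎-finite B ⊎-finite B ⊎-finite P ⊎-finite P ⊎-finite A ⊎-finite A)
    where
    B = finite-Fin (suc m) ×-finite finite-Fin p
    P = finite-Fin p
    A = finite-Fin m ×-finite finite-Fin (p ∸ 1)

    Code : Set
    Code = (Fin (suc m) × Fin p) ⊎ (Fin (suc m) × Fin p) ⊎ (Fin (suc m) × Fin p)
         ⊎ Fin p ⊎ Fin p ⊎ (Fin m × Fin (p ∸ 1)) ⊎ (Fin m × Fin (p ∸ 1))

    to : Leaf → Code
    to (at-b i j) = inj₁ (i , j)
    to (at-d i j) = inj₂ (inj₁ (i , j))
    to (at-t i j) = inj₂ (inj₂ (inj₁ (i , j)))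
    to (at-a₀ j)  = inj₂ (inj₂ (inj₂ (inj₁ j)))
    to (at-cₘ j)  = inj₂ (inj₂ (inj₂ (inj₂ (inj₁ j))))
    to (at-a i j) = inj₂ (inj₂ (inj₂ (inj₂ (inj₂ (inj₁ (i , j))))))
    to (at-c i j) = inj₂ (inj₂ (inj₂ (inj₂ (inj₂ (inj₂ (i , j))))))

    from : Code → Leaf
    from (inj₁ (i , j))                                     = at-b i j
    from (inj₂ (inj₁ (i , j)))                              = at-d i j
    from (inj₂ (inj₂ (inj₁ (i , j))))                       = at-t i j
    from (inj₂ (inj₂ (inj₂ (inj₁ j))))                      = at-a₀ j
    from (inj₂ (inj₂ (inj₂ (inj₂ (inj₁ j)))))               = at-cₘ j
    from (inj₂ (inj₂ (inj₂ (inj₂ (inj₂ (inj₁ (i , j)))))))  = at-a i j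
    from (inj₂ (inj₂ (inj₂ (inj₂ (inj₂ (inj₂ (i , j)))))))  = at-c i j

    to∘from : ∀ x → to (from x) ≡ x
    to∘from (inj₁ _)                                    = refl
    to∘from (inj₂ (inj₁ _))                             = refl
    to∘from (inj₂ (inj₂ (inj₁ _)))                      = refl
    to∘from (inj₂ (inj₂ (inj₂ (inj₁ _))))               = refl
    to∘from (inj₂ (inj₂ (inj₂ (inj₂ (inj₁ _)))))        = refl
    to∘from (inj₂ (inj₂ (inj₂ (inj₂ (inj₂ (inj₁ _)))))) = refl
    to∘from (inj₂ (inj₂ (inj₂ (inj₂ (inj₂ (inj₂ _)))))) = refl

    from∘to : ∀ L → from (to L) ≡ L
    from∘to (at-b _ _) = refl
    from∘to (at-d _ _) = refl
    from∘to (at-t _ _) = refl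
    from∘to (at-a₀ _)  = refl
    from∘to (at-cₘ _)  = refl
    from∘to (at-a _ _) = refl
    from∘to (at-c _ _) = refl

  finite-Vertex : Finite Vertex
  finite-Vertex = finite-↔ (mk↔ₛ′ to from to∘from from∘to)
    (finite-Fin p ⊎-finite (finite-Fin (suc m) ×-finite finite-Fin 5)
                  ⊎-finite (finite-Leaf ×-finite finite-Fin 5))
    where
    Code : Set
    Code = Fin p ⊎ (Fin (suc m) × Pentagon) ⊎ (Leaf × Pentagon)

    to : Vertex → Code
    to (q j)   = inj₁ j
    to (s i x) = inj₂ (inj₁ (i , x))
    to (ℓ L x) = inj₂ (inj₂ (L , x))

    from : Code → Vertex
    from (inj₁ j)              = q j
    from (inj₂ (inj₁ (i , x))) = s i x
    from (inj₂ (inj₂ (L , x))) = ℓ L x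

    to∘from : ∀ x → to (from x) ≡ x
    to∘from (inj₁ _)        = refl
    to∘from (inj₂ (inj₁ _)) = refl
    to∘from (inj₂ (inj₂ _)) = refl

    from∘to : ∀ x → from (to x) ≡ x
    from∘to (q _)   = refl
    from∘to (s _ _) = refl
    from∘to (ℓ _ _) = refl

  infix 4 _⟶_ _⟶?_ _~_

  -- Every edge is listed in at least one direction.
  _⟶_ : Rel Vertex 0ℓ
  q j   ⟶ q j′    = j ≢ j′
  s i x ⟶ s i′ y  = (i ≡ i′ × y ≡ next x)
                  ⊎ (toℕ i′ ≡ suc (toℕ i) × x ≡ cᵢ × y ≡ aᵢ)
  s i x ⟶ ℓ L y   = base L ≡ (i , x) × y ≡ root
  ℓ L x ⟶ ℓ L′ y  = L ≡ L′ × y ≡ next x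
  ℓ L x ⟶ q j     = x ≢ root ⊎ j ≢ index L
  q _   ⟶ s _ _   = ⊥
  q _   ⟶ ℓ _ _   = ⊥
  s _ _ ⟶ q _     = ⊥
  ℓ _ _ ⟶ s _ _   = ⊥

  _⟶?_ : Decidable _⟶_
  q j   ⟶? q j′    = ¬? (j ≟ j′)
  s i x ⟶? s i′ y  = ((i ≟ i′) ×-dec (y ≟ next x))
    ⊎-dec ((toℕ i′ ≟ℕ suc (toℕ i)) ×-dec (x ≟ cᵢ) ×-dec (y ≟ aᵢ))
  s i x ⟶? ℓ L y   = ≡-dec _≟_ _≟_ (base L) (i , x) ×-dec (y ≟ root)
  ℓ L x ⟶? ℓ L′ y  = finite⇒≟ finite-Leaf L L′ ×-dec (y ≟ next x)
  ℓ L x ⟶? q j     = ¬? (x ≟ root) ⊎-dec ¬? (j ≟ index L)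
  q _   ⟶? s _ _   = no id
  q _   ⟶? ℓ _ _   = no id
  s _ _ ⟶? q _     = no id
  ℓ _ _ ⟶? s _ _   = no id

  ⟶-irrefl : ∀ x → ¬ (x ⟶ x)
  ⟶-irrefl (q _)   j≢j              = j≢j refl
  ⟶-irrefl (s _ x) (inj₁ (_ , e))   = next-≢ x e
  ⟶-irrefl (s _ _) (inj₂ (e , _))   = 1+n≢n (sym e)
  ⟶-irrefl (ℓ _ x) (_ , e)          = next-≢ x e

  _~_ : Rel Vertex 0ℓ
  x ~ y = x ⟶ y ⊎ y ⟶ x

  graph : Graph
  graph = record
    { V        = Vertex
    ; finite   = finite-Vertex
    ; _~_      = _~_
    ; _~?_     = λ x y → (x ⟶? y) ⊎-dec (y ⟶? x)
    ; ~-sym    = swap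
    ; ~-irrefl = λ { {x} refl → [ ⟶-irrefl x , ⟶-irrefl x ]′ }
    }

H : ℕ → ℕ → Graph
H k m = Construction.graph (k ∸ 3) m

{-# OPTIONS --safe #-}

-- Lower bound: in a colouring with k - 1 colours the path of a leaf L_j(x)
-- uses up the two colours missing on Q, so its root repeats the colour of q_j
-- and x avoids it.  Thus b, d, t never get a colour of Q, and a pentagon Sᵢ,
-- being an odd cycle, passes "aᵢ has no colour of Q" on to aᵢ₊₁ through cᵢ
-- with the colour of q₁; at c_m this is impossible.
--
-- Critical: Sᵢ may break this chain as soon as an edge in Sᵢ, at cᵢ, or at a
-- leaf attached to Sᵢ is missing; before Sᵢ the vertex c and after Sᵢ the
-- vertex a carries the colour of q₁.
--
-- Chords: outside Q the graph is a tree of pentagons, so a cycle Z longer than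
-- a pentagon enters every leaf it meets directly from Q.  Each vertex of Q has
-- two cycle edges, hence Z meets at most 2p leaves, and an edge inside or
-- between the pentagons Sᵢ can only be a chord next to such a leaf.
module Submission where

open import Defs
open import Data.Bool using (Bool; true; false; T)
open import Data.Fin using (Fin; zero; suc; toℕ; fromℕ; fromℕ<; inject₁; inject≤; _≟_)
open import Data.Fin.Induction using (<-weakInduction)
open import Data.Fin.Patterns using (0F; 1F; 2F; 3F; 4F)
open import Data.Fin.Properties
  using (2↔Bool; any?; cantor-schröder-bernstein; fromℕ≢inject₁; inject₁-injective;
         inject≤-injective; injective⇒≤; pigeonhole; toℕ<n; toℕ-fromℕ; toℕ-fromℕ<;
         toℕ-inject₁; toℕ-injective)
  renaming (<-cmp to <ᶠ-cmp; suc-injective to suc-injectiveᶠ)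
open import Data.List
  using (List; []; _∷_; _++_; map; length; lookup; filter; allFin; cartesianProduct)
open import Data.List.Membership.Propositional using (_∈_)
open import Data.List.Membership.Propositional.Properties
  using (∈-lookup; ∈-map⁺; ∈-++⁺ˡ; ∈-++⁺ʳ; ∈-allFin; ∈-filter⁻)
open import Data.List.Properties using (length-++; length-map; length-tabulate)
import Data.List.Relation.Unary.All as All
open import Data.List.Relation.Unary.AllPairs using (_∷_)
open import Data.List.Relation.Unary.Any.Properties using (lookup-index)
open import Data.List.Relation.Unary.Unique.Propositional using (Unique)
import Data.List.Relation.Unary.Unique.Propositional.Properties as Unique
open import Data.Nat
  using (ℕ; zero; suc; _+_; _*_; _∸_; _^_; _≤_; _<_; z≤n; s≤s; s<s; s≤s⁻¹; _≤?_)
open import Data.Nat.Combinatorics using (_C_; nC1≡n; nCk+nC[k+1]≡[n+1]C[k+1])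
open import Data.Nat.Properties
  using (1+n≢0; *-cancelˡ-≡; *-distribˡ-+; *-mono-≤; *-monoʳ-≤; *-monoˡ-≤; +-assoc;
         +-cancelʳ-≡; +-monoʳ-≤; <-asym; <-irrefl; <-trans; <-≤-trans; <⇒≤; <⇒≱; ≤∧≢⇒<;
         ≮⇒≥; ≰⇒>; m+[n∸m]≡n; m+n∸m≡n; m<n⇒0<n∸m; m≢1+n+m; m≤m+n; m≤n+m;
         n<1+n; n≤1+n; n≮0; suc-injective; _<?_; module ≤-Reasoning)
  renaming (_≟_ to _≟ℕ_)
open import Data.Nat.Solver using (module +-*-Solver)
open import Data.Product using (Σ-syntax; ∃-syntax; ∃; _×_; _,_; proj₁; proj₂)
  renaming (swap to ×-swap)
open import Data.Sum using (_⊎_; inj₁; inj₂; swap; [_,_]′)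
open import Function using (_∘_; id)
open import Function.Bundles using (_↔_; module Inverse; module Injection)
open import Function.Properties.Inverse using (↔-sym; ↔-trans; ↔⇒↣)
open import Level using (0ℓ)
open import Relation.Binary.Core using (Rel)
open import Relation.Binary.Definitions using (tri<; tri≈; tri>)
open import Relation.Binary.PropositionalEquality
  using (_≡_; _≢_; refl; sym; trans; cong; cong₂; subst; module ≡-Reasoning)
open import Relation.Nullary
  using (¬_; Dec; yes; no; contradiction; _×-dec_; _⊎-dec_)
open import Relation.Nullary.Decidable using () renaming (map′ to mapDec)
import Relation.Unary as U

-- Counting a duplicate-free list by codes

lookup-injective : ∀ {A : Set} {xs : List A} → Unique xs →
  ∀ {i j} → lookup xs i ≡ lookup xs j → i ≡ j
lookup-injective (_ ∷ _)  {zero}  {zero}  _  = refl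
lookup-injective (x∉ ∷ _) {zero}  {suc j} eq = contradiction eq (All.lookup x∉ (∈-lookup j))
lookup-injective (x∉ ∷ _) {suc i} {zero}  eq = contradiction (sym eq) (All.lookup x∉ (∈-lookup i))
lookup-injective (_ ∷ u)  {suc i} {suc j} eq = cong suc (lookup-injective u eq)

-- Choosing a code at each position injects the positions into the finite type `B`. `R` is a
-- relation because one element may have several codes, any of which will do.
length≤codes : ∀ {A B : Set} {xs : List A} → Unique xs → (fin : Finite B) →
  (R : A → B → Set) → (∀ {x} → x ∈ xs → ∃ (R x)) →
  (∀ {x y b} → R x b → R y b → x ≡ y) → length xs ≤ proj₁ fin
length≤codes {xs = xs} unique (_ , φ) R encode decode =
  injective⇒≤ {f = λ i → Inverse.to φ (code i)} λ {i} {j} eq →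
    lookup-injective unique
      (decode (coded i)
        (subst (R (lookup xs j)) (sym (Injection.injective (↔⇒↣ φ) eq)) (coded j)))
  where
  code  = λ i → proj₁ (encode (∈-lookup {xs = xs} i))
  coded = λ i → proj₂ (encode (∈-lookup {xs = xs} i))

-- Rotation of the pentagon

prev : Pentagon → Pentagon
prev 0F = 4F
prev 1F = 0F
prev 2F = 1F
prev 3F = 2F
prev 4F = 3F

prev-next : ∀ x → prev (next x) ≡ x
prev-next 0F = refl
prev-next 1F = refl
prev-next 2F = refl
prev-next 3F = refl
prev-next 4F = refl

next-prev : ∀ x → next (prev x) ≡ x
next-prev 0F = refl
next-prev 1F = refl
next-prev 2F = refl
next-prev 3F = refl
next-prev 4F = refl

-- The cyclic order on Fin n

follower : ∀ {n} (i : Fin n) → ∃[ j ] Follows i j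
follower {suc n} i with suc (toℕ i) <? suc n
... | yes i+1<n = fromℕ< i+1<n , inj₁ (toℕ-fromℕ< i+1<n)
... | no  i+1≮n with suc (toℕ i) ≟ℕ suc n
... | yes i+1≡n = zero , inj₂ (i+1≡n , refl)
... | no  i+1≢n = contradiction (≤∧≢⇒< (toℕ<n i) i+1≢n) i+1≮n

predecessor : ∀ {n} (j : Fin n) → ∃[ i ] Follows i j
predecessor {suc n} zero    = fromℕ n , inj₂ (cong suc (toℕ-fromℕ n) , refl)
predecessor {suc n} (suc j) = inject₁ j , inj₁ (cong suc (sym (toℕ-inject₁ j)))

follows-deterministic : ∀ {n} {i j k : Fin n} → Follows i j → Follows i k → j ≡ k
follows-deterministic (inj₁ e) (inj₁ e′) = toℕ-injective (trans e (sym e′))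
follows-deterministic {j = j} (inj₁ e) (inj₂ (e′ , _)) =
  contradiction (toℕ<n j) (<-irrefl (trans e e′))
follows-deterministic {k = k} (inj₂ (e , _)) (inj₁ e′) =
  contradiction (toℕ<n k) (<-irrefl (trans e′ e))
follows-deterministic (inj₂ (_ , e)) (inj₂ (_ , e′)) = toℕ-injective (trans e (sym e′))

follows-injective : ∀ {n} {i j k : Fin n} → Follows i k → Follows j k → i ≡ j
follows-injective (inj₁ e) (inj₁ e′) = toℕ-injective (suc-injective (trans (sym e) e′))
follows-injective (inj₁ e) (inj₂ (_ , e′)) with () ← trans (sym e) e′
follows-injective (inj₂ (_ , e)) (inj₁ e′) with () ← trans (sym e) e′
follows-injective (inj₂ (e , _)) (inj₂ (e′ , _)) =
  toℕ-injective (suc-injective (trans e (sym e′)))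

-- A step undone by wrapping around would force `n` to be 1 or 2.
follows-asym : ∀ {n} → 3 ≤ n → {i j : Fin n} → Follows i j → ¬ Follows j i
follows-asym _ {i} (inj₁ e) (inj₁ e′) = m≢1+n+m (toℕ i) {1} (trans e′ (cong suc e))
follows-asym 3≤n (inj₁ e) (inj₂ (e′ , e″)) rewrite e | e″ with e′ | 3≤n
... | refl | s≤s (s≤s ())
follows-asym 3≤n (inj₂ (e , e′)) (inj₁ e″) rewrite e′ | e″ with e | 3≤n
... | refl | s≤s (s≤s ())
follows-asym 3≤n (inj₂ (e , e′)) (inj₂ (e″ , _)) rewrite e′ with e″ | 3≤n
... | refl | s≤s ()

-- The links between neighbouring numbers suffice: the property is carried from `i` down to `zero`
-- and up again to `j`.
consecutive-closed : ∀ {n} (P : Fin n → Set) →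
  (∀ {i j} → Consecutive i j → P i → P j) → ∀ i j → P i → P j
consecutive-closed {suc n} P closed i j Pi = up j (down i Pi)
  where
  link : (k : Fin n) → Follows (inject₁ k) (suc k)
  link k = inj₁ (cong suc (sym (toℕ-inject₁ k)))

  down : ∀ k → P k → P zero
  down = <-weakInduction (λ k → P k → P zero) (λ z → z)
    (λ k ih → ih ∘ closed (inj₂ (link k)))

  up : ∀ k → P zero → P k
  up = <-weakInduction (λ k → P zero → P k) (λ z → z)
    (λ k ih → closed (inj₁ (link k)) ∘ ih)

-- Edges of a cycle

module CycleEdges {G : Graph} (Z : Cycle G) where
  open Graph G using (_~_; ~-sym; finite)
  open Cycle Z

  infix 4 _≈_

  -- The edges of Z, as opposed to the edges of G spanned by its vertices.
  _≈_ : V G → V G → Set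
  x ≈ y = ∃[ i ] ∃[ j ] (Consecutive i j × at i ≡ x × at j ≡ y)

  On : V G → Set
  On x = ∃[ i ] at i ≡ x

  ≈-sym : ∀ {x y} → x ≈ y → y ≈ x
  ≈-sym (i , j , c , ex , ey) = j , i , swap c , ey , ex

  ≈⇒On : ∀ {x y} → x ≈ y → On x
  ≈⇒On (i , _ , _ , ex , _) = i , ex

  ≈⇒~ : ∀ {x y} → x ≈ y → x ~ y
  ≈⇒~ (_ , _ , inj₁ i→j , refl , refl) = adjacent i→j
  ≈⇒~ (_ , _ , inj₂ j→i , refl , refl) = ~-sym (adjacent j→i)

  step : Bool → Fin len → Fin len
  step true  i = proj₁ (follower i)
  step false i = proj₁ (predecessor i)

  step-consecutive : ∀ d i → Consecutive i (step d i)
  step-consecutive true  i = inj₁ (proj₂ (follower i))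
  step-consecutive false i = inj₂ (proj₂ (predecessor i))

  consecutive-step : ∀ {i j} → Consecutive i j → ∃[ d ] step d i ≡ j
  consecutive-step (inj₁ i→j) = true  , follows-deterministic (proj₂ (follower _)) i→j
  consecutive-step (inj₂ j→i) = false , follows-injective (proj₂ (predecessor _)) j→i

  step-≈ : ∀ d i → at i ≈ at (step d i)
  step-≈ d i = i , step d i , step-consecutive d i , refl , refl

  ≈-step : ∀ {i y} → at i ≈ y → ∃[ d ] at (step d i) ≡ y
  ≈-step (i′ , j , c , e , ey) with injective e
  ... | refl with consecutive-step c
  ... | d , refl = d , ey

  step-≢ : ∀ i → at (step true i) ≢ at (step false i)
  step-≢ i e = follows-asym 3≤len (proj₂ (follower i))
    (subst (λ j → Follows j i) (sym (injective e)) (proj₂ (predecessor i)))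

  two-neighbours : ∀ {x} → On x → ∃[ y ] ∃[ z ] (x ≈ y × x ≈ z × y ≢ z)
  two-neighbours (i , refl) = _ , _ , step-≈ true i , step-≈ false i , step-≢ i

  -- Two distinct cycle neighbours drawn from two candidates exhaust the candidates.
  forced : ∀ {x y z} → On x → (∀ {w} → x ≈ w → w ≡ y ⊎ w ≡ z) → x ≈ y × x ≈ z
  forced on only with two-neighbours on
  ... | w , w′ , xw , xw′ , w≢w′ with only xw | only xw′
  ... | inj₁ refl | inj₁ refl = contradiction refl w≢w′
  ... | inj₁ refl | inj₂ refl = xw , xw′
  ... | inj₂ refl | inj₁ refl = xw′ , xw
  ... | inj₂ refl | inj₂ refl = contradiction refl w≢w′

  -- The two directions at a position give all its cycle neighbours, and `y ≢ z` means that both are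
  -- taken.
  no-third : ∀ {x y z w} → x ≈ y → x ≈ z → y ≢ z → x ≈ w → w ≡ y ⊎ w ≡ z
  no-third xy@(i , _ , _ , refl , _) xz y≢z xw with ≈-step xy | ≈-step xz | ≈-step xw
  ... | true  , refl | true  , refl | _            = contradiction refl y≢z
  ... | false , refl | false , refl | _            = contradiction refl y≢z
  ... | true  , refl | false , refl | true  , refl = inj₁ refl
  ... | true  , refl | false , refl | false , refl = inj₂ refl
  ... | false , refl | true  , refl | true  , refl = inj₂ refl
  ... | false , refl | true  , refl | false , refl = inj₁ refl

  closed⇒everywhere : (P : V G → Set) → (∀ {x y} → x ≈ y → P x → P y) →
    ∀ {x} → On x → P x → ∀ j → P (at j)
  closed⇒everywhere P closed (i , refl) Px j =
    consecutive-closed (P ∘ at) (λ c → closed (_ , _ , c , refl , refl)) i j Px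

  chord-≉ : ∀ {i j} → ¬ Consecutive i j → ¬ (at i ≈ at j)
  chord-≉ ¬c (i′ , j′ , c , ei , ej) with injective ei | injective ej
  ... | refl | refl = ¬c c

  -- A search through all pairs of positions; it makes the case distinctions on how `Z` leaves a
  -- leaf or a pentagon constructive.
  joins? : ∀ {P Q : V G → Set} → U.Decidable P → U.Decidable Q →
    Dec (∃[ x ] ∃[ y ] (x ≈ y × P x × Q y))
  joins? {P} {Q} P? Q? = mapDec
    (λ (i , j , c , Pi , Qj) → _ , _ , (i , j , c , refl , refl) , Pi , Qj)
    (λ { (_ , _ , (i , j , c , refl , refl) , Pi , Qj) → i , j , c , Pi , Qj })
    (any? λ i → any? λ j → (follows? i j ⊎-dec follows? j i) ×-dec P? (at i) ×-dec Q? (at j))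

  module Pentagons (f : Pentagon → V G) (f-injective : ∀ {x y} → f x ≡ f y → x ≡ y) where

    -- Only edges of `Z` are restricted: in the graph, `f x` may have neighbours outside the
    -- pentagon.
    Inner : Pentagon → Set
    Inner x = ∀ {y} → f x ≈ y → y ≡ f (next x) ⊎ y ≡ f (prev x)

    Trapped : Set
    Trapped = ∀ i → ∃[ x ] at i ≡ f x

    inner-next : ∀ {x} → Inner x → On (f x) → f x ≈ f (next x)
    inner-next inner on = proj₁ (forced on inner)

    inner-prev : ∀ {x} → Inner x → On (f x) → f x ≈ f (prev x)
    inner-prev inner on = proj₂ (forced on inner)

    -- The four inner vertices pass Z on to each other, which makes both
    -- neighbours of the fifth one known as well.
    trap : Inner 1F → Inner 2F → Inner 3F → Inner 4F → ∀ {x} → x ≢ 0F → On (f x) → Trapped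
    trap i₁ i₂ i₃ i₄ x≢0 on = closed⇒everywhere (λ y → ∃[ x ] y ≡ f x) closed on₁ (1F , refl)
      where
      back₂ : On (f 2F) → On (f 1F)
      back₂ = ≈⇒On ∘ ≈-sym ∘ inner-prev i₂

      back₃ : On (f 3F) → On (f 1F)
      back₃ = back₂ ∘ ≈⇒On ∘ ≈-sym ∘ inner-prev i₃

      back₄ : On (f 4F) → On (f 1F)
      back₄ = back₃ ∘ ≈⇒On ∘ ≈-sym ∘ inner-prev i₄

      reach₁ : ∀ {x} → x ≢ 0F → On (f x) → On (f 1F)
      reach₁ {0F} x≢0 _ = contradiction refl x≢0
      reach₁ {1F} _     = λ on → on
      reach₁ {2F} _     = back₂
      reach₁ {3F} _     = back₃
      reach₁ {4F} _     = back₄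

      on₁ = reach₁ x≢0 on
      on₂ = ≈⇒On (≈-sym (inner-next i₁ on₁))
      on₃ = ≈⇒On (≈-sym (inner-next i₂ on₂))
      on₄ = ≈⇒On (≈-sym (inner-next i₃ on₃))

      i₀ : Inner 0F
      i₀ = no-third (≈-sym (inner-prev i₁ on₁)) (≈-sym (inner-next i₄ on₄))
        (λ e → contradiction (f-injective e) λ ())

      inner : ∀ x → Inner x
      inner 0F = i₀
      inner 1F = i₁
      inner 2F = i₂
      inner 3F = i₃
      inner 4F = i₄

      closed : ∀ {y z} → y ≈ z → (∃[ x ] y ≡ f x) → ∃[ x ] z ≡ f x
      closed yz (x , refl) = [ (_ ,_) , (_ ,_) ]′ (inner x yz)

    trapped⇒len≤5 : Trapped → len ≤ 5
    trapped⇒len≤5 t = injective⇒≤ {f = λ i → proj₁ (t i)} λ {i} {j} e →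
      injective (trans (proj₂ (t i)) (trans (cong f e) (sym (proj₂ (t j)))))

-- Chords of a cycle in H

pairs : ∀ n → List (Fin n × Fin n)
pairs zero    = []
pairs (suc n) = map (λ j → zero , suc j) (allFin n) ++ map (λ (i , j) → suc i , suc j) (pairs n)

length-pairs : ∀ n → length (pairs n) ≡ n C 2
length-pairs zero    = refl
length-pairs (suc n) = begin
  length (pairs (suc n))
    ≡⟨ length-++ (map (λ j → zero , suc j) (allFin n)) ⟩
  length (map (λ j → zero {n} , suc j) (allFin n)) + length (map (λ (i , j) → suc i , suc j) (pairs n))
    ≡⟨ cong₂ _+_ (trans (length-map _ (allFin n)) (length-tabulate id)) (length-map _ (pairs n)) ⟩
  n + length (pairs n)  ≡⟨ cong₂ _+_ (sym (nC1≡n n)) (length-pairs n) ⟩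
  n C 1 + n C 2         ≡⟨ nCk+nC[k+1]≡[n+1]C[k+1] n 1 ⟩
  suc n C 2             ∎
  where open ≡-Reasoning

∈-pairs : ∀ {n} {i j : Fin n} → toℕ i < toℕ j → (i , j) ∈ pairs n
∈-pairs {i = zero}  {suc j} _         = ∈-++⁺ˡ (∈-map⁺ _ (∈-allFin j))
∈-pairs {i = suc _} {suc _} (s<s i<j) = ∈-++⁺ʳ _ (∈-map⁺ _ (∈-pairs i<j))

module Chords (p m : ℕ) (Z : Cycle (Construction.graph p m)) where
  open Construction p m
  open Cycle Z
  open CycleEdges Z

  chords-unique : Unique (filter chord? (cartesianProduct (allFin len) (allFin len)))
  chords-unique =
    Unique.filter⁺ chord? (Unique.cartesianProduct⁺ (Unique.allFin⁺ len) (Unique.allFin⁺ len))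

  ℓ-injective : ∀ {L x y} → ℓ L x ≡ ℓ L y → x ≡ y
  ℓ-injective refl = refl

  s-injective : ∀ {i x y} → s i x ≡ s i y → x ≡ y
  s-injective refl = refl

  IsQ IsLeaf : Vertex → Set
  IsQ v    = ∃[ j ] v ≡ q j
  IsLeaf v = ∃[ L ] ∃[ x ] v ≡ ℓ L x

  InLeaf : Leaf → Vertex → Set
  InLeaf L v = ∃[ x ] v ≡ ℓ L x

  InSpine : Fin (suc m) → Vertex → Set
  InSpine i v = ∃[ x ] v ≡ s i x

  isQ? : U.Decidable IsQ
  isQ? (q j)   = yes (j , refl)
  isQ? (s _ _) = no λ ()
  isQ? (ℓ _ _) = no λ ()

  isLeaf? : U.Decidable IsLeaf
  isLeaf? (q _)   = no λ ()
  isLeaf? (s _ _) = no λ ()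
  isLeaf? (ℓ L x) = yes (L , x , refl)

  inLeaf? : ∀ L → U.Decidable (InLeaf L)
  inLeaf? L (q _)    = no λ ()
  inLeaf? L (s _ _)  = no λ ()
  inLeaf? L (ℓ L′ x) = mapDec (λ { refl → x , refl }) (λ { (_ , refl) → refl })
    (finite⇒≟ finite-Leaf L L′)

  inSpine? : ∀ i → U.Decidable (InSpine i)
  inSpine? i (q _)    = no λ ()
  inSpine? i (s i′ x) = mapDec (λ { refl → x , refl }) (λ { (_ , refl) → refl }) (i ≟ i′)
  inSpine? i (ℓ _ _)  = no λ ()

  ℓ-neighbours : ∀ {L x y} → ℓ L x ~ y →
    (y ≡ ℓ L (next x) ⊎ y ≡ ℓ L (prev x)) ⊎ IsQ y
    ⊎ (x ≡ root × y ≡ s (proj₁ (base L)) (proj₂ (base L)))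
  ℓ-neighbours {y = q j}   _                      = inj₂ (inj₁ (j , refl))
  ℓ-neighbours {y = s _ _} (inj₁ ())
  ℓ-neighbours {y = s _ _} (inj₂ (e , e′))        =
    inj₂ (inj₂ (e′ , cong (λ (i , x) → s i x) (sym e)))
  ℓ-neighbours {y = ℓ _ _} (inj₁ (refl , refl))   = inj₁ (inj₁ refl)
  ℓ-neighbours {y = ℓ L y} (inj₂ (refl , refl))   =
    inj₁ (inj₂ (cong (ℓ L) (sym (prev-next y))))

  -- The last alternative is deliberately coarse: `a` is the vertex `0F`, whose cycle neighbours
  -- `trap` derives from the other four.
  s-neighbours : ∀ {i x y} → s i x ~ y →
    (y ≡ s i (next x) ⊎ y ≡ s i (prev x))
    ⊎ (∃[ L ] (base L ≡ (i , x) × y ≡ ℓ L root))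
    ⊎ (∃[ i′ ] (toℕ i′ ≡ suc (toℕ i) × x ≡ cᵢ × y ≡ s i′ aᵢ))
    ⊎ x ≡ aᵢ
  s-neighbours {y = q _}   (inj₁ ())
  s-neighbours {y = q _}   (inj₂ ())
  s-neighbours {y = s _ _} (inj₁ (inj₁ (refl , refl)))     = inj₁ (inj₁ refl)
  s-neighbours {y = s _ _} (inj₁ (inj₂ (e , refl , refl))) = inj₂ (inj₂ (inj₁ (_ , e , refl , refl)))
  s-neighbours {y = s i y} (inj₂ (inj₁ (refl , refl)))     =
    inj₁ (inj₂ (cong (s i) (sym (prev-next y))))
  s-neighbours {y = s _ _} (inj₂ (inj₂ (_ , _ , e)))       = inj₂ (inj₂ (inj₂ e))
  s-neighbours {y = ℓ L _} (inj₁ (e , refl))               = inj₂ (inj₁ (L , e , refl))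
  s-neighbours {y = ℓ _ _} (inj₂ ())

  -- An end of a component of Z minus Q: a vertex of Q together with one of
  -- the two directions in which Z leaves it.
  Slot : Set
  Slot = Fin p × Bool

  data LeafAt (L : Leaf) : Slot → Set where
    leaf-at : ∀ {i j d x} → at i ≡ q j → at (step d i) ≡ ℓ L x → LeafAt L (j , d)

  -- A pentagon Sᵢ borrows the slot of a leaf hanging on it.
  SpineAt : Fin (suc m) → Slot → Set
  SpineAt i c = ∃[ L ] (proj₁ (base L) ≡ i × LeafAt L c)

  -- A vertex of Q has at most one position on `Z`, so a slot leads to a single vertex and hence
  -- into a single leaf.
  leafAt-unique : ∀ {L L′ c} → LeafAt L c → LeafAt L′ c → L ≡ L′
  leafAt-unique (leaf-at {d = d} e₁ e₂) (leaf-at e₃ e₄) with injective (trans e₁ (sym e₃))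
  ... | refl with trans (sym e₂) e₄
  ... | refl = refl

  spineAt-unique : ∀ {i i′ c} → SpineAt i c → SpineAt i′ c → i ≡ i′
  spineAt-unique (_ , refl , l) (_ , refl , l′) = cong (proj₁ ∘ base) (leafAt-unique l l′)

  module Long (5<len : 5 < len) where

    -- Without a cycle edge to Q, the four vertices other than the root are inner. The root has only
    -- one neighbour outside leaf and Q, so one of its two cycle neighbours lies in the leaf. Either
    -- way `Z` is trapped in a pentagon, against its length.
    leaf-slot : ∀ {L x} → On (ℓ L x) → ∃ (LeafAt L)
    leaf-slot {L} {x} on with joins? (inLeaf? L) isQ?
    ... | yes (_ , _ , e , (y , refl) , (j , refl)) with ≈-sym e
    ... | (i , _ , c , ei , ej) with consecutive-step c
    ... | d , refl = (j , d) , leaf-at {d = d} ei ej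
    leaf-slot {L} {x} on | no ¬exit = contradiction (all-trapped x on) not-trapped
      where
      open Pentagons (ℓ L) ℓ-injective

      not-trapped : ¬ Trapped
      not-trapped t = <⇒≱ 5<len (trapped⇒len≤5 t)

      inner : ∀ {x} → x ≢ root → Inner x
      inner x≢root e with ℓ-neighbours (≈⇒~ e)
      ... | inj₁ z               = z
      ... | inj₂ (inj₁ y)        = contradiction (_ , _ , e , (_ , refl) , y) ¬exit
      ... | inj₂ (inj₂ (x≡ , _)) = contradiction x≡ x≢root

      trapped : ∀ {x} → x ≢ root → On (ℓ L x) → Trapped
      trapped = trap (inner λ ()) (inner λ ()) (inner λ ()) (inner λ ())

      root-neighbour : ∀ {y} → ℓ L root ≈ y → Trapped ⊎ y ≡ s (proj₁ (base L)) (proj₂ (base L))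
      root-neighbour e with ℓ-neighbours (≈⇒~ e)
      ... | inj₁ (inj₁ refl)     = inj₁ (trapped (λ ()) (≈⇒On (≈-sym e)))
      ... | inj₁ (inj₂ refl)     = inj₁ (trapped (λ ()) (≈⇒On (≈-sym e)))
      ... | inj₂ (inj₁ y)        = contradiction (_ , _ , e , (_ , refl) , y) ¬exit
      ... | inj₂ (inj₂ (_ , e′)) = inj₂ e′

      all-trapped : ∀ x → On (ℓ L x) → Trapped
      all-trapped 0F on with two-neighbours on
      ... | _ , _ , e , e′ , ≢ with root-neighbour e | root-neighbour e′
      ... | inj₁ t | _      = t
      ... | _      | inj₁ t = t
      ... | inj₂ b | inj₂ b′ = contradiction (trans b (sym b′)) ≢
      all-trapped 1F = trapped λ ()
      all-trapped 2F = trapped λ ()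
      all-trapped 3F = trapped λ ()
      all-trapped 4F = trapped λ ()

    LeafFree : Fin (suc m) → Set
    LeafFree i = ¬ (∃[ x ] ∃[ y ] (x ≈ y × InSpine i x × IsLeaf y))

    spine-slot : ∀ i → ∃ (SpineAt i) ⊎ LeafFree i
    spine-slot i with joins? (inSpine? i) isLeaf?
    ... | no  free = inj₂ free
    ... | yes (_ , _ , e , (_ , refl) , (L , _ , refl)) with ≈⇒~ e | leaf-slot (≈⇒On (≈-sym e))
    ... | inj₁ (b , _) | c , l = inj₁ (c , L , cong proj₁ b , l)

    module _ {i : Fin (suc m)} (free : LeafFree i) where
      open Pentagons (s i) s-injective

      inner : ∀ {x} → x ≢ aᵢ → x ≢ cᵢ → Inner x
      inner x≢a x≢c e with s-neighbours (≈⇒~ e)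
      ... | inj₁ z                                = z
      ... | inj₂ (inj₁ (_ , _ , refl))            =
        contradiction (_ , _ , e , (_ , refl) , (_ , _ , refl)) free
      ... | inj₂ (inj₂ (inj₁ (_ , _ , x≡c , _)))  = contradiction x≡c x≢c
      ... | inj₂ (inj₂ (inj₂ x≡a))                = contradiction x≡a x≢a

      -- Each edge of the pentagon has an end among b, d, t. These are inner when `Z` takes no edge
      -- to a leaf, so `Z` uses both pentagon edges at each of them that it meets.
      no-pentagon-chord : ∀ x → On (s i x) → On (s i (next x)) → s i x ≈ s i (next x)
      no-pentagon-chord aᵢ _ on = ≈-sym (inner-prev (inner (λ ()) λ ()) on)
      no-pentagon-chord bᵢ on _ = inner-next (inner (λ ()) λ ()) on
      no-pentagon-chord cᵢ _ on = ≈-sym (inner-prev (inner (λ ()) λ ()) on)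
      no-pentagon-chord dᵢ on _ = inner-next (inner (λ ()) λ ()) on
      no-pentagon-chord tᵢ on _ = inner-next (inner (λ ()) λ ()) on

      -- If `Z` avoids the edge from cᵢ to aᵢ₊₁, then c is inner along with b, d, t, and `Z` is
      -- trapped in the pentagon.
      no-bridge-chord : ∀ {i′} → toℕ i′ ≡ suc (toℕ i) → On (s i cᵢ) → ¬ ¬ (s i cᵢ ≈ s i′ aᵢ)
      no-bridge-chord i′≡i+1 on chord = <⇒≱ 5<len (trapped⇒len≤5
        (trap (inner (λ ()) λ ()) inner-c (inner (λ ()) λ ()) (inner (λ ()) λ ()) {cᵢ} (λ ()) on))
        where
        inner-c : Inner cᵢ
        inner-c e with s-neighbours (≈⇒~ e)
        ... | inj₁ z                     = z
        ... | inj₂ (inj₁ (_ , _ , refl)) =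
          contradiction (_ , _ , e , (_ , refl) , (_ , _ , refl)) free
        ... | inj₂ (inj₂ (inj₁ (_ , i″≡i+1 , _ , refl)))
          with refl ← toℕ-injective (trans i″≡i+1 (sym i′≡i+1)) = contradiction e chord

    -- The summands serve the edges inside Q, those from leaves to Q, those at and inside a leaf,
    -- and those leaving and inside a pentagon Sᵢ. In `Fin 6`, `zero` is the connecting edge and
    -- `suc x` the pentagon edge at `x`.
    Code : Set
    Code = Fin (length (pairs p))
      ⊎ (Slot × Pentagon × Fin p)
      ⊎ (Slot × Fin 6)
      ⊎ (Slot × Fin 6)

    finite-Slot : Finite Slot
    finite-Slot = finite-Fin p ×-finite (2 , ↔-sym 2↔Bool)

    finite-Code : Finite Code
    finite-Code = finite-Fin _
      ⊎-finite (finite-Slot ×-finite finite-Fin 5 ×-finite finite-Fin p)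
      ⊎-finite (finite-Slot ×-finite finite-Fin 6)
      ⊎-finite (finite-Slot ×-finite finite-Fin 6)

    -- Leaves and pentagons Sᵢ are named by slots, never by themselves, so the number of codes is
    -- independent of `m`.
    data Codes : Vertex → Vertex → Code → Set where
      qq : ∀ {j j′ n} → (j , j′) ≡ lookup (pairs p) n → Codes (q j) (q j′) (inj₁ n)
      ℓq : ∀ {L x j c} → LeafAt L c → Codes (ℓ L x) (q j) (inj₂ (inj₁ (c , x , j)))
      sℓ : ∀ {L i x c} → base L ≡ (i , x) → LeafAt L c →
           Codes (s i x) (ℓ L root) (inj₂ (inj₂ (inj₁ (c , zero))))
      ℓℓ : ∀ {L x c} → LeafAt L c →
           Codes (ℓ L x) (ℓ L (next x)) (inj₂ (inj₂ (inj₁ (c , suc x))))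
      cᵢaᵢ₊₁ : ∀ {i i′ c} → toℕ i′ ≡ suc (toℕ i) → SpineAt i c →
           Codes (s i cᵢ) (s i′ aᵢ) (inj₂ (inj₂ (inj₂ (c , zero))))
      ss : ∀ {i x c} → SpineAt i c →
           Codes (s i x) (s i (next x)) (inj₂ (inj₂ (inj₂ (c , suc x))))

    codes-injective : ∀ {x y x′ y′ c} → Codes x y c → Codes x′ y′ c → x ≡ x′ × y ≡ y′
    codes-injective (qq e) (qq e′) with refl ← trans e (sym e′) = refl , refl
    codes-injective (ℓq l) (ℓq l′) with refl ← leafAt-unique l l′ = refl , refl
    codes-injective (sℓ b l) (sℓ b′ l′) with refl ← leafAt-unique l l′
      with refl ← trans (sym b) b′ = refl , refl
    codes-injective (ℓℓ l) (ℓℓ l′) with refl ← leafAt-unique l l′ = refl , refl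
    codes-injective (cᵢaᵢ₊₁ e l) (cᵢaᵢ₊₁ e′ l′) with refl ← spineAt-unique l l′
      with refl ← toℕ-injective (trans e (sym e′)) = refl , refl
    codes-injective (ss l) (ss l′) with refl ← spineAt-unique l l′ = refl , refl

    CodesEdge : Vertex → Vertex → Code → Set
    CodesEdge x y c = Codes x y c ⊎ Codes y x c

    -- Being a chord matters for edges inside or between the pentagons Sᵢ: there it excludes
    -- pentagons without a slot. Edges inside Q and edges meeting a leaf on `Z` always have a code.
    encode-⟶ : ∀ x y → On x → On y → x ⟶ y → ¬ (x ≈ y) → ∃ (CodesEdge x y)
    encode-⟶ (q j) (q j′) _ _ j≢j′ _ with <ᶠ-cmp j j′
    ... | tri< j<j′ _ _ = _ , inj₁ (qq (lookup-index (∈-pairs j<j′)))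
    ... | tri≈ _ j≡j′ _ = contradiction j≡j′ j≢j′
    ... | tri> _ _ j′<j = _ , inj₂ (qq (lookup-index (∈-pairs j′<j)))
    encode-⟶ (s i x) (s _ _) onx ony (inj₁ (refl , refl)) chord with spine-slot i
    ... | inj₁ (_ , l) = _ , inj₁ (ss l)
    ... | inj₂ free    = contradiction (no-pentagon-chord free x onx ony) chord
    encode-⟶ (s i _) (s _ _) onx _ (inj₂ (e , refl , refl)) chord with spine-slot i
    ... | inj₁ (_ , l) = _ , inj₁ (cᵢaᵢ₊₁ e l)
    ... | inj₂ free    = contradiction chord (no-bridge-chord free e onx)
    encode-⟶ (s _ _) (ℓ _ _) _ ony (b , refl) _ = _ , inj₁ (sℓ b (proj₂ (leaf-slot ony)))
    encode-⟶ (ℓ _ _) (ℓ _ _) onx _ (refl , refl) _ = _ , inj₁ (ℓℓ (proj₂ (leaf-slot onx)))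
    encode-⟶ (ℓ _ _) (q _) onx _ _ _ = _ , inj₁ (ℓq (proj₂ (leaf-slot onx)))
    encode-⟶ (q _) (s _ _) _ _ () _
    encode-⟶ (q _) (ℓ _ _) _ _ () _
    encode-⟶ (s _ _) (q _) _ _ () _
    encode-⟶ (ℓ _ _) (s _ _) _ _ () _

    ChordCode : Fin len × Fin len → Code → Set
    ChordCode (i , j) c = toℕ i < toℕ j × CodesEdge (at i) (at j) c

    encode : ∀ {ij} → Chord ij → ∃ (ChordCode ij)
    encode {i , j} (i<j , inj₁ e , ¬cons) with encode-⟶ _ _ (i , refl) (j , refl) e (chord-≉ ¬cons)
    ... | c , codes = c , i<j , codes
    encode {i , j} (i<j , inj₂ e , ¬cons) with encode-⟶ _ _ (j , refl) (i , refl) e (chord-≉ ¬cons ∘ ≈-sym)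
    ... | c , codes = c , i<j , swap codes

    decode : ∀ {ij ij′ c} → ChordCode ij c → ChordCode ij′ c → ij ≡ ij′
    decode (i<j , inj₁ e) (i′<j′ , inj₁ e′) with codes-injective e e′
    ... | e₁ , e₂ = cong₂ _,_ (injective e₁) (injective e₂)
    decode (i<j , inj₁ e) (i′<j′ , inj₂ e′) with codes-injective e e′
    ... | e₁ , e₂ with injective e₁ | injective e₂
    -- Opposite orientations of the same edge cannot both list its positions in increasing order.
    ... | refl | refl = contradiction i′<j′ (<-asym i<j)
    decode (i<j , inj₂ e) (i′<j′ , inj₁ e′) with codes-injective e e′
    ... | e₁ , e₂ with injective e₁ | injective e₂
    ... | refl | refl = contradiction i′<j′ (<-asym i<j)
    decode (i<j , inj₂ e) (i′<j′ , inj₂ e′) with codes-injective e e′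
    ... | e₁ , e₂ = cong₂ _,_ (injective e₂) (injective e₁)

    #chords≤#codes : #chords ≤ proj₁ finite-Code
    #chords≤#codes = length≤codes chords-unique finite-Code ChordCode
      (encode ∘ proj₂ ∘ ∈-filter⁻ chord? {xs = cartesianProduct (allFin len) (allFin len)}) decode

  #chords≤len² : #chords ≤ len * len
  #chords≤len² = length≤codes chords-unique (finite-Fin len ×-finite finite-Fin len) _≡_
    (λ _ → _ , refl) (λ e e′ → trans e (sym e′))

  #chords-bound : 1 ≤ p → #chords ≤ p C 2 + 10 * p ^ 2 + 60 * p
  #chords-bound 1≤p with len ≤? 5
  ... | yes len≤5 = begin
    -- A short cycle has at most 25 pairs of positions.
    #chords     ≤⟨ #chords≤len² ⟩
    len * len   ≤⟨ *-mono-≤ len≤5 len≤5 ⟩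
    25          ≤⟨ m≤m+n 25 35 ⟩
    60 * 1      ≤⟨ *-monoʳ-≤ 60 1≤p ⟩
    60 * p      ≤⟨ m≤n+m (60 * p) (p C 2 + 10 * p ^ 2) ⟩
    p C 2 + 10 * p ^ 2 + 60 * p ∎
    where open ≤-Reasoning
  ... | no len≰5 = begin
    #chords                     ≤⟨ Long.#chords≤#codes (≰⇒> len≰5) ⟩
    -- Each of the 2p slots accounts for 5p edges between a leaf and Q, 6 edges of a leaf and 6 of a
    -- pentagon Sᵢ.
    length (pairs p) + (p * 2 * (5 * p) + (p * 2 * 6 + p * 2 * 6))
      ≡⟨ cong₂ _+_ (length-pairs p) (solve 1 (λ p →
           p :* con 2 :* (con 5 :* p) :+ (p :* con 2 :* con 6 :+ p :* con 2 :* con 6)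
           := con 10 :* p :^ 2 :+ con 24 :* p) refl p) ⟩
    p C 2 + (10 * p ^ 2 + 24 * p) ≤⟨ +-monoʳ-≤ (p C 2) (+-monoʳ-≤ (10 * p ^ 2) (*-monoˡ-≤ p (m≤m+n 24 36))) ⟩
    p C 2 + (10 * p ^ 2 + 60 * p) ≡⟨ +-assoc (p C 2) _ _ ⟨
    p C 2 + 10 * p ^ 2 + 60 * p ∎
    where
    open ≤-Reasoning
    open +-*-Solver

-- Chromatic number and criticality

module Uncolourable (p′ m : ℕ) where
  open Construction (suc p′) m

  module _ (f : Vertex → Fin (3 + p′)) (proper : ∀ {x y} → x ~ y → f x ≢ f y) where

    q-clash : ∀ {j j′} → f (q j) ≡ f (q j′) → j ≡ j′
    q-clash {j} {j′} e with j ≟ j′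
    ... | yes j≡j′ = j≡j′
    ... | no  j≢j′ = contradiction e (proper (inj₁ j≢j′))

    OffQ : Fin (3 + p′) → Set
    OffQ c = ∀ j → c ≢ f (q j)

    -- Pigeonhole on `c`, `y`, `z` and the colours of Q, one more than there are colours: every
    -- coincidence not involving `c` is excluded.
    palette : ∀ {y z} → OffQ y → OffQ z → y ≢ z →
      ∀ c → (∃[ j ] c ≡ f (q j)) ⊎ (c ≡ y ⊎ c ≡ z)
    palette {y} {z} offy offz y≢z c with pigeonhole (n<1+n _) g
      where
      g : Fin (4 + p′) → Fin (3 + p′)
      g 0F = c
      g 1F = y
      g 2F = z
      g (suc (suc (suc j))) = f (q j)
    ... | 0F , 1F , _ , e = inj₂ (inj₁ e)
    ... | 0F , 2F , _ , e = inj₂ (inj₂ e)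
    ... | 0F , suc (suc (suc j)) , _ , e = inj₁ (j , e)
    ... | 1F , 2F , _ , e = contradiction e y≢z
    ... | 1F , suc (suc (suc j)) , _ , e = contradiction e (offy j)
    ... | 2F , suc (suc (suc j)) , _ , e = contradiction e (offz j)
    ... | suc (suc (suc i)) , suc (suc (suc j)) , s<s (s<s (s<s i<j)) , e
      with refl ← q-clash {i} {j} e = contradiction i<j (<-irrefl refl)
    ... | 1F , 1F , s<s () , _
    ... | 2F , 1F , s<s () , _
    ... | 2F , 2F , s<s (s<s ()) , _
    ... | suc (suc (suc _)) , 1F , s<s () , _
    ... | suc (suc (suc _)) , 2F , s<s (s<s ()) , _

    leaf-offQ : ∀ L {x} → x ≢ root → OffQ (f (ℓ L x))
    leaf-offQ L x≢root j = proper (inj₁ (inj₁ x≢root))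

    leaf-edge : ∀ L x → f (ℓ L x) ≢ f (ℓ L (next x))
    leaf-edge L x = proper (inj₁ (refl , refl))

    -- Only two colours are missing on Q, so along a path that avoids the colours of Q, vertices two
    -- apart agree.
    repeat : ∀ {y z c} → OffQ y → OffQ z → y ≢ z → OffQ c → z ≢ c → c ≡ y
    repeat offy offz y≢z offc z≢c with palette offy offz y≢z _
    ... | inj₁ (j , e)    = contradiction e (offc j)
    ... | inj₂ (inj₁ e)   = e
    ... | inj₂ (inj₂ e)   = contradiction (sym e) z≢c

    root-colour : ∀ L → f (ℓ L root) ≡ f (q (index L))
    root-colour L with palette (leaf-offQ L {1F} λ ()) (leaf-offQ L {2F} λ ()) (leaf-edge L 1F) (f (ℓ L root))
    ... | inj₂ (inj₁ r≡u) = contradiction r≡u (leaf-edge L 0F)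
    ... | inj₂ (inj₂ r≡v) = contradiction (trans z≡v (sym r≡v)) (leaf-edge L 4F)
      where
      -- The path u v w z alternates, so the neighbours u and z of the root carry both missing
      -- colours.
      z≡v = repeat (leaf-offQ L {2F} λ ()) (leaf-offQ L {3F} λ ()) (leaf-edge L 2F)
                   (leaf-offQ L {4F} λ ()) (leaf-edge L 3F)
    ... | inj₁ (j , e) with j ≟ index L
    ... | yes refl = e
    ... | no  j≢   = contradiction e (proper (inj₁ (inj₂ j≢)))

    base-colour : ∀ L → f (s (proj₁ (base L)) (proj₂ (base L))) ≢ f (q (index L))
    base-colour L e = proper (inj₁ (refl , refl)) (trans e (sym (root-colour L)))

    spine-edge : ∀ i x → f (s i x) ≢ f (s i (next x))
    spine-edge i x = proper (inj₁ (inj₁ (refl , refl)))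

    -- With two colours left, c repeats a and t repeats c, yet t and a are adjacent.
    not-odd-cycle : ∀ i → (∀ x → OffQ (f (s i x))) → ∀ {A : Set} → A
    not-odd-cycle i off = contradiction (trans t≡c c≡a) (spine-edge i tᵢ)
      where
      c≡a = repeat (off aᵢ) (off bᵢ) (spine-edge i aᵢ) (off cᵢ) (spine-edge i bᵢ)
      t≡c = repeat (off cᵢ) (off dᵢ) (spine-edge i cᵢ) (off tᵢ) (spine-edge i dᵢ)

    spine-offQ : ∀ i → OffQ (f (s i aᵢ)) → OffQ (f (s i cᵢ)) → ∀ x → OffQ (f (s i x))
    spine-offQ i offa offc aᵢ = offa
    spine-offQ i offa offc bᵢ = base-colour ∘ at-b i
    spine-offQ i offa offc cᵢ = offc
    spine-offQ i offa offc dᵢ = base-colour ∘ at-d i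
    spine-offQ i offa offc tᵢ = base-colour ∘ at-t i

    a-offQ : ∀ i → OffQ (f (s i aᵢ))
    a-offQ = <-weakInduction (λ i → OffQ (f (s i aᵢ))) (base-colour ∘ at-a₀) step
      where
      step : ∀ i → OffQ (f (s (inject₁ i) aᵢ)) → OffQ (f (s (suc i) aᵢ))
      step i off (suc j) e = base-colour (at-a i j) e
      -- If aᵢ₊₁ had the colour of q₁, its neighbour cᵢ would avoid it, and the leaves at cᵢ exclude
      -- the other colours of Q.
      step i off zero    e = not-odd-cycle (inject₁ i) (spine-offQ (inject₁ i) off λ where
        (suc j) → base-colour (at-c i j)
        zero e′ → proper (inj₁ (inj₂ (cong suc (sym (toℕ-inject₁ i)) , refl , refl)))
                    (trans e′ (sym e)))

    uncolourable : ∀ {A : Set} → A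
    uncolourable = not-odd-cycle (fromℕ m)
      (spine-offQ (fromℕ m) (a-offQ (fromℕ m)) (base-colour ∘ at-cₘ))

-- Colouring a graph with one edge missing

-- Instead of deleting the edge, a clash is tolerated on it, in either orientation.
ColourableWithout : (G : Graph) → V G → V G → ℕ → Set
ColourableWithout G x₀ y₀ n = Σ[ f ∈ (V G → Fin n) ]
  (∀ {x y} → Graph._~_ G x y → f x ≡ f y → (x ≡ x₀ × y ≡ y₀) ⊎ (x ≡ y₀ × y ≡ x₀))

-- A fresh colour at the end `x₀` removes the only clash.
without-edge⇒colourable : ∀ G {x₀ y₀ n} → ColourableWithout G x₀ y₀ n →
  Colourable (Graph._~_ G) (suc n)
without-edge⇒colourable G {x₀} {y₀} {n} (f , only) = g , g-proper
  where
  open Graph G using (_~_; ~-irrefl; finite)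

  g : V G → Fin (suc n)
  g v with finite⇒≟ finite v x₀
  ... | yes _ = zero
  ... | no  _ = suc (f v)

  g-proper : ∀ {x y} → x ~ y → g x ≢ g y
  g-proper {x} {y} x~y e with finite⇒≟ finite x x₀ | finite⇒≟ finite y x₀
  ... | yes refl | yes refl = ~-irrefl refl x~y
  ... | no x≢ | no y≢ with only x~y (suc-injectiveᶠ e)
  ... | inj₁ (x≡ , _) = x≢ x≡
  ... | inj₂ (_ , y≡) = y≢ y≡

-- A missing vertex takes an incident edge with it, so every proper subgraph lacks some edge.
critical : ∀ {G n} → (∀ {x y} → Graph._~_ G x y → ColourableWithout G x y n) →
  (∀ x → ∃[ y ] Graph._~_ G x y) → ∀ (S : Subgraph G) → Subgraph.Proper S →
  Colourable (Subgraph.Adjacent S) n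
critical {G} {n} without neighbour S = [ missing-vertex , missing-edge ]′
  where
  open Graph G using (_~_)
  open Subgraph S

  missing-edge : ∃[ x ] ∃[ y ] (x ~ y × ¬ T (inE x y)) → Colourable Adjacent n
  missing-edge (x , y , x~y , ∉) with without x~y
  ... | f , only = f ∘ proj₁ , λ {(v , _)} {(w , _)} v~w e → absurd v~w (only (inE⇒~ v~w) e)
    where
    absurd : ∀ {v w} → T (inE v w) → ¬ ((v ≡ x × w ≡ y) ⊎ (v ≡ y × w ≡ x))
    absurd v~w (inj₁ (refl , refl)) = ∉ v~w
    absurd v~w (inj₂ (refl , refl)) = ∉ (inE-sym v~w)

  missing-vertex : ∃[ x ] ¬ T (inV x) → Colourable Adjacent n
  missing-vertex (x , ∉) with neighbour x
  ... | y , x~y = missing-edge (x , y , x~y , ∉ ∘ inE⇒inV)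

-- Colourings of a pentagon with one special vertex

pattern α     = zero
pattern β     = suc zero
pattern col j = suc (suc j)

alternate : ∀ {n} → Fin (2 + n) → Pentagon → Fin (2 + n)
alternate c 0F = c
alternate c 1F = α
alternate c 2F = β
alternate c 3F = α
alternate c 4F = β

infixl 6 _⊖_

-- Subtraction modulo 5, a rotation taking the second argument to `0F`.
_⊖_ : Pentagon → Pentagon → Pentagon
x ⊖ 0F = x
x ⊖ 1F = prev x
x ⊖ 2F = prev (prev x)
x ⊖ 3F = next (next x)
x ⊖ 4F = next x

next-⊖ : ∀ x y → next x ⊖ y ≡ next (x ⊖ y)
next-⊖ x 0F = refl
next-⊖ x 1F = trans (prev-next x) (sym (next-prev x))
next-⊖ x 2F = trans (cong prev (prev-next x)) (sym (next-prev (prev x)))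
next-⊖ x 3F = refl
next-⊖ x 4F = refl

⊖-self : ∀ y → y ⊖ y ≡ 0F
⊖-self 0F = refl
⊖-self 1F = refl
⊖-self 2F = refl
⊖-self 3F = refl
⊖-self 4F = refl

⊖≡0⇒≡ : ∀ x y → x ⊖ y ≡ 0F → x ≡ y
⊖≡0⇒≡ x 0F e = e
⊖≡0⇒≡ x 1F e = trans (sym (next-prev x)) (cong next e)
⊖≡0⇒≡ x 2F e = trans (sym (next-prev x)) (cong next (⊖≡0⇒≡ (prev x) 1F e))
⊖≡0⇒≡ x 3F e = trans (sym (prev-next x)) (cong prev (trans (sym (prev-next (next x))) (cong prev e)))
⊖≡0⇒≡ x 4F e = trans (sym (prev-next x)) (cong prev e)

-- The vertex y gets the colour c and the other four alternate; c = β is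
-- the 2-colouring of the path left when the edge into y is missing.
pentagon : ∀ {n} → Pentagon × Fin (2 + n) → Pentagon → Fin (2 + n)
pentagon (y , c) x = alternate c (x ⊖ y)

pentagon-special : ∀ {n} y {c : Fin (2 + n)} → pentagon (y , c) y ≡ c
pentagon-special y {c} = cong (alternate c) (⊖-self y)

pentagon-col : ∀ {n} y {c} x {j : Fin n} → pentagon (y , c) x ≡ col j → x ≡ y × c ≡ col j
pentagon-col y x e with x ⊖ y in x⊖y | e
... | 0F | e′ = ⊖≡0⇒≡ x y x⊖y , e′
... | 1F | ()
... | 2F | ()
... | 3F | ()
... | 4F | ()

-- The alternating path is proper, so a clash involves the special vertex: with the α after it or
-- the β before it.
pentagon-clash : ∀ {n} y {c : Fin (2 + n)} x →
  pentagon (y , c) x ≡ pentagon (y , c) (next x) → c ≡ α ⊎ (next x ≡ y × c ≡ β)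
pentagon-clash y {c} x e with x ⊖ y in x⊖y | trans e (cong (alternate c) (next-⊖ x y))
... | 0F | e′ = inj₁ e′
... | 1F | ()
... | 2F | ()
... | 3F | ()
... | 4F | e′ = inj₂ (⊖≡0⇒≡ (next x) y (trans (next-⊖ x y) (cong next x⊖y)) , sym e′)

-- Colourings of `graph` without one edge

module EdgeRemoval (p′ m : ℕ) where
  open Construction (suc p′) m

  Colour : Set
  Colour = Fin (3 + p′)

  -- At an end of an edge between two pentagons Sᵢ no leaf of index 1 is attached, which lets that
  -- end take the colour of q₁; `index-c` is the counterpart for the other end.
  index-a : ∀ L {i} → base L ≡ (i , aᵢ) → toℕ i ≢ 0 → index L ≢ zero
  index-a (at-a₀ _)  refl i≢0 = contradiction refl i≢0
  index-a (at-a _ _) refl _   = λ ()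

  index-c : ∀ L {i} → base L ≡ (i , cᵢ) → toℕ i < m → index L ≢ zero
  index-c (at-cₘ _)  refl i<m = contradiction i<m (<-irrefl (toℕ-fromℕ m))
  index-c (at-c _ _) refl _   = λ ()

  -- Each vertex has at most one leaf of each index, so disabling one leaf frees its colour at the
  -- base.
  base-index-injective : ∀ L L′ → base L ≡ base L′ → index L ≡ index L′ → L ≡ L′
  base-index-injective (at-b _ _) (at-b _ _) refl refl = refl
  base-index-injective (at-d _ _) (at-d _ _) refl refl = refl
  base-index-injective (at-t _ _) (at-t _ _) refl refl = refl
  base-index-injective (at-a₀ _)  (at-a₀ _)  _    refl = refl
  base-index-injective (at-cₘ _)  (at-cₘ _)  _    refl = refl
  base-index-injective (at-a _ _) (at-a _ _) refl refl = refl
  base-index-injective (at-c _ _) (at-c _ _) e    refl =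
    cong (λ i → at-c i _) (inject₁-injective (cong proj₁ e))
  base-index-injective (at-cₘ _)  (at-c _ _) e    _    =
    contradiction (cong proj₁ e) fromℕ≢inject₁
  base-index-injective (at-c _ _) (at-cₘ _)  e    _    =
    contradiction (sym (cong proj₁ e)) fromℕ≢inject₁

  standard : Leaf → Pentagon × Colour
  standard L = root , col (index L)

  -- On the pentagons before Sᵢ the special vertex is c, on those after Sᵢ it
  -- is a, both with the colour of q₁; this leaves Sᵢ unconstrained.
  module Break (i₀ : Fin (suc m)) (special : Pentagon × Colour)
    (leaf : Leaf → Pentagon × Colour) where

    spine : Fin (suc m) → Pentagon × Colour
    spine i with <ᶠ-cmp i i₀
    ... | tri< _ _ _ = cᵢ , col zero
    ... | tri≈ _ _ _ = special
    ... | tri> _ _ _ = aᵢ , col zero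

    colouring : Vertex → Colour
    colouring (q j)   = col j
    colouring (s i x) = pentagon (spine i) x
    colouring (ℓ L x) = pentagon (leaf L) x

    -- `E` holds the tolerated clashes. The hypotheses cover the places where one could occur: in
    -- the pentagon with index `i₀`, on its connections to neighbouring pentagons and leaves, and at
    -- the leaf pentagons themselves.
    module Clashes (E : Rel Vertex 0ℓ)
      (ss : ∀ x → pentagon special x ≡ pentagon special (next x) → E (s i₀ x) (s i₀ (next x)))
      (enter : toℕ i₀ ≢ 0 → pentagon special aᵢ ≢ col zero)
      (leave : ∀ {i} → toℕ i ≡ suc (toℕ i₀) → pentagon special cᵢ ≡ col zero →
               E (s i₀ cᵢ) (s i aᵢ))
      (away : ∀ L → leaf L ≡ standard L ⊎ proj₁ (base L) ≡ i₀)
      (sℓ : ∀ L {x} → base L ≡ (i₀ , x) → pentagon special x ≡ pentagon (leaf L) root →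
            E (s i₀ x) (ℓ L root))
      (ℓℓ : ∀ L x → pentagon (leaf L) x ≡ pentagon (leaf L) (next x) → E (ℓ L x) (ℓ L (next x)))
      (ℓq : ∀ L x j → ℓ L x ⟶ q j → pentagon (leaf L) x ≡ col j → E (ℓ L x) (q j))
      where

      away-root : ∀ L → proj₁ (base L) ≢ i₀ → pentagon (leaf L) root ≡ col (index L)
      away-root L ≢i₀ with away L
      ... | inj₁ e = cong (λ w → pentagon w root) e
      ... | inj₂ e = contradiction e ≢i₀

      i≮i′ : ∀ {i i′ : ℕ} → i′ ≡ suc i → ¬ (i′ < i)
      i≮i′ refl i+1<i = <⇒≱ i+1<i (n≤1+n _)

      clash : ∀ {x y} → x ⟶ y → colouring x ≡ colouring y → E x y
      clash {q _} {q _} j≢j′ e = contradiction (suc-injectiveᶠ (suc-injectiveᶠ e)) j≢j′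
      clash {s i x} {s _ _} (inj₁ (refl , refl)) e with <ᶠ-cmp i i₀
      clash {s i x} {s _ _} (inj₁ (refl , refl)) e | tri< _ _ _ with pentagon-clash cᵢ x e
      ... | inj₁ ()
      ... | inj₂ (_ , ())
      clash {s i x} {s _ _} (inj₁ (refl , refl)) e | tri≈ _ refl _ = ss x e
      clash {s i x} {s _ _} (inj₁ (refl , refl)) e | tri> _ _ _ with pentagon-clash aᵢ x e
      ... | inj₁ ()
      ... | inj₂ (_ , ())
      clash {s i _} {s i′ _} (inj₂ (i′≡ , refl , refl)) e with <ᶠ-cmp i i₀ | <ᶠ-cmp i′ i₀
      ... | tri< _ _ _ | tri< _ _ _ = contradiction e λ ()
      ... | tri< _ _ _ | tri≈ _ refl _ =
        contradiction (sym e) (enter (1+n≢0 ∘ trans (sym i′≡)))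
      -- No index lies strictly between two successive ones.
      ... | tri< i<i₀ _ _ | tri> _ _ i₀<i′ =
        contradiction (s≤s⁻¹ (subst (toℕ i₀ <_) i′≡ i₀<i′)) (<⇒≱ i<i₀)
      ... | tri≈ _ refl _ | tri> _ _ _ = leave i′≡ e
      ... | tri≈ _ refl _ | tri< i′<i _ _ =
        contradiction i′<i (i≮i′ i′≡)
      ... | tri≈ _ refl _ | tri≈ _ refl _ = contradiction (n<1+n _) (<-irrefl i′≡)
      ... | tri> _ _ i₀<i | tri< i′<i₀ _ _ =
        contradiction (<-trans i′<i₀ i₀<i) (i≮i′ i′≡)
      ... | tri> _ _ i₀<i | tri≈ _ refl _ =
        contradiction i₀<i (i≮i′ i′≡)
      ... | tri> _ _ _ | tri> _ _ _ = contradiction e λ ()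
      clash {s i x} {ℓ L _} (b , refl) e with <ᶠ-cmp i i₀
      -- Before `i₀` only c has a colour of Q, that of q₁, and no leaf of index 1 hangs there since
      -- `i` is below `m`.
      ... | tri< i<i₀ ≢i₀ _ with pentagon-col cᵢ x (trans e (away-root L (≢i₀ ∘ trans (sym (cong proj₁ b)))))
      ... | refl , e′ = contradiction (sym (suc-injectiveᶠ (suc-injectiveᶠ e′)))
        (index-c L b (<-≤-trans i<i₀ (s≤s⁻¹ (toℕ<n i₀))))
      clash {s i x} {ℓ L _} (b , refl) e | tri≈ _ refl _ = sℓ L b e
      clash {s i x} {ℓ L _} (b , refl) e | tri> _ ≢i₀ i>i₀
        with pentagon-col aᵢ x (trans e (away-root L (≢i₀ ∘ trans (sym (cong proj₁ b)))))
      ... | refl , e′ = contradiction (sym (suc-injectiveᶠ (suc-injectiveᶠ e′)))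
        (index-a L b λ i≡0 → n≮0 (subst (toℕ i₀ <_) i≡0 i>i₀))
      clash {ℓ L x} {ℓ _ _} (refl , refl) e = ℓℓ L x e
      clash {ℓ L x} {q j} edge e = ℓq L x j edge e

  col-injective : ∀ {j j′} → _≡_ {A = Colour} (col j) (col j′) → j ≡ j′
  col-injective = suc-injectiveᶠ ∘ suc-injectiveᶠ

  col-proper : ∀ y {j : Fin (suc p′)} x →
    pentagon (y , col j) x ≢ pentagon (y , col j) (next x)
  col-proper y x e with pentagon-clash y x e
  ... | inj₁ ()
  ... | inj₂ (_ , ())

  β-uncoloured : ∀ y x {j : Fin (suc p′)} → pentagon (y , β) x ≢ col j
  β-uncoloured y x e with () ← proj₂ (pentagon-col y x e)

  standard-ℓq : ∀ L x j → ℓ L x ⟶ q j → pentagon (standard L) x ≢ col j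
  standard-ℓq L x j edge e with pentagon-col root x e | edge
  ... | x≡root , _    | inj₁ x≢root = x≢root x≡root
  ... | _      , e′   | inj₂ j≢     = j≢ (sym (col-injective e′))

  SameEdge : Vertex → Vertex → Rel Vertex 0ℓ
  SameEdge x₀ y₀ x y = (x ≡ x₀ × y ≡ y₀) ⊎ (x ≡ y₀ × y ≡ x₀)

  directed : ∀ {x₀ y₀} (f : Vertex → Colour) →
    (∀ {x y} → x ⟶ y → f x ≡ f y → SameEdge x₀ y₀ x y) →
    ColourableWithout graph x₀ y₀ (3 + p′)
  directed f only = f , λ where
    (inj₁ x⟶y) e → only x⟶y e
    (inj₂ y⟶x) e → [ inj₂ ∘ ×-swap , inj₁ ∘ ×-swap ]′ (only y⟶x (sym e))

  -- The remaining path needs only α and β, which clash neither with the leaf roots nor with the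
  -- colour of q₁ on the adjoining pentagons.
  without-ss : ∀ i x → ColourableWithout graph (s i x) (s i (next x)) (3 + p′)
  without-ss i x = directed colouring (clash (SameEdge _ _)
    (λ y e → ss y (pentagon-clash (next x) y e))
    (λ _ → β-uncoloured (next x) aᵢ)
    (λ _ e → contradiction e (β-uncoloured (next x) cᵢ))
    (λ _ → inj₁ refl)
    (λ L {y} _ e → contradiction e (β-uncoloured (next x) y))
    (λ L y e → contradiction e (col-proper root y))
    (λ L y j edge e → contradiction e (standard-ℓq L y j edge)))
    where
    open Break i (next x , β) standard
    open Clashes

    ss : ∀ y → _≡_ {A = Colour} β α ⊎ (next y ≡ next x × _) →
         SameEdge (s i x) (s i (next x)) (s i y) (s i (next y))
    ss y (inj₁ ())
    ss y (inj₂ (e , _)) with refl ← trans (sym (prev-next y)) (trans (cong prev e) (prev-next x)) =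
      inj₁ (refl , refl)

  -- Both ends take the colour of q₁; the leaves at cᵢ have other indices.
  without-ca : ∀ {i i′} → toℕ i′ ≡ suc (toℕ i) →
    ColourableWithout graph (s i cᵢ) (s i′ aᵢ) (3 + p′)
  without-ca {i} {i′} i′≡i+1 = directed colouring (clash (SameEdge _ _)
    (λ y e → contradiction e (col-proper cᵢ y))
    (λ _ ())
    (λ i″≡i+1 _ → inj₁ (refl , cong (λ i → s i aᵢ) (toℕ-injective (trans i″≡i+1 (sym i′≡i+1)))))
    (λ _ → inj₁ refl)
    (λ L {y} b e → sℓ L b (pentagon-col cᵢ y e))
    (λ L y e → contradiction e (col-proper root y))
    (λ L y j edge e → contradiction e (standard-ℓq L y j edge)))
    where
    open Break i (cᵢ , col zero) standard
    open Clashes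

    sℓ : ∀ L {y} → base L ≡ (i , y) → y ≡ cᵢ × _≡_ {A = Colour} (col zero) (col (index L)) →
         SameEdge (s i cᵢ) (s i′ aᵢ) (s i y) (ℓ L root)
    sℓ L b (refl , e) = contradiction (sym (col-injective e))
      (index-c L b (s≤s⁻¹ (subst (_< suc m) i′≡i+1 (toℕ<n i′))))

  -- If an edge at the leaf L is missing, the base of L may take the colour
  -- of q with the index of L.
  module AtLeaf (L₀ : Leaf) (w : Pentagon × Colour) where
    i₀ : Fin (suc m)
    i₀ = proj₁ (base L₀)

    x₀ : Pentagon
    x₀ = proj₂ (base L₀)

    leaf : Leaf → Pentagon × Colour
    leaf L with finite⇒≟ finite-Leaf L L₀
    ... | yes _ = w
    ... | no  _ = standard L

    open Break i₀ (x₀ , col (index L₀)) leaf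

    -- Other leaves at the base have other indices, and a base joined to another pentagon Sᵢ has
    -- index other than 1, so only edges at `L₀` remain to be checked.
    without-leaf-edge : ∀ {u v} →
      (pentagon w root ≡ col (index L₀) → SameEdge u v (s i₀ x₀) (ℓ L₀ root)) →
      (∀ x → pentagon w x ≡ pentagon w (next x) → SameEdge u v (ℓ L₀ x) (ℓ L₀ (next x))) →
      (∀ x j → ℓ L₀ x ⟶ q j → pentagon w x ≡ col j → SameEdge u v (ℓ L₀ x) (q j)) →
      ColourableWithout graph u v (3 + p′)
    without-leaf-edge {u} {v} at-base in-leaf to-Q = directed colouring (clash E
      (λ y e → contradiction e (col-proper x₀ y))
      (λ i₀≢0 e → enter i₀≢0 (pentagon-col x₀ aᵢ e))
      (λ i≡ e → leave i≡ (pentagon-col x₀ cᵢ e))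
      away sℓ ℓℓ ℓq)
      where
      open Clashes
      E = SameEdge u v

      enter : toℕ i₀ ≢ 0 → ¬ (aᵢ ≡ x₀ × _≡_ {A = Colour} (col (index L₀)) (col zero))
      enter i₀≢0 (a≡x₀ , e) = index-a L₀ (cong (i₀ ,_) (sym a≡x₀)) i₀≢0 (col-injective e)

      leave : ∀ {i} → toℕ i ≡ suc (toℕ i₀) →
        cᵢ ≡ x₀ × _≡_ {A = Colour} (col (index L₀)) (col zero) → E (s i₀ cᵢ) (s i aᵢ)
      leave {i} i≡ (c≡x₀ , e) = contradiction (col-injective e)
        (index-c L₀ (cong (i₀ ,_) (sym c≡x₀)) (s≤s⁻¹ (subst (_< suc m) i≡ (toℕ<n i))))

      away : ∀ L → leaf L ≡ standard L ⊎ proj₁ (base L) ≡ i₀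
      away L with finite⇒≟ finite-Leaf L L₀
      ... | yes refl = inj₂ refl
      ... | no  _    = inj₁ refl

      sℓ : ∀ L {x} → base L ≡ (i₀ , x) →
        pentagon (x₀ , col (index L₀)) x ≡ pentagon (leaf L) root → E (s i₀ x) (ℓ L root)
      sℓ L {x} b e with finite⇒≟ finite-Leaf L L₀
      sℓ L {x} refl e | yes refl = at-base (trans (sym e) (pentagon-special x₀))
      sℓ L {x} b e | no L≢L₀ with pentagon-col x₀ x e
      ... | refl , e′ = contradiction (base-index-injective L L₀ b (sym (col-injective e′))) L≢L₀

      ℓℓ : ∀ L x → pentagon (leaf L) x ≡ pentagon (leaf L) (next x) → E (ℓ L x) (ℓ L (next x))
      ℓℓ L x e with finite⇒≟ finite-Leaf L L₀
      ... | yes refl = in-leaf x e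
      ... | no  _    = contradiction e (col-proper root x)

      ℓq : ∀ L x j → ℓ L x ⟶ q j → pentagon (leaf L) x ≡ col j → E (ℓ L x) (q j)
      ℓq L x j edge e with finite⇒≟ finite-Leaf L L₀
      ... | yes refl = to-Q x j edge e
      ... | no  _    = contradiction e (standard-ℓq L x j edge)

  without-sℓ : ∀ L {i x} → base L ≡ (i , x) → ColourableWithout graph (s i x) (ℓ L root) (3 + p′)
  without-sℓ L refl = AtLeaf.without-leaf-edge L (standard L)
    (λ _ → inj₁ (refl , refl))
    (λ x e → contradiction e (col-proper root x))
    (λ x j edge e → contradiction e (standard-ℓq L x j edge))

  -- The leaf becomes a path coloured with α and β, so its root gives up the colour that blocked the
  -- base.
  without-ℓℓ : ∀ L x → ColourableWithout graph (ℓ L x) (ℓ L (next x)) (3 + p′)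
  without-ℓℓ L x = AtLeaf.without-leaf-edge L (next x , β)
    (λ e → contradiction e (β-uncoloured (next x) root))
    (λ y e → in-leaf y (pentagon-clash (next x) y e))
    (λ y j _ e → contradiction e (β-uncoloured (next x) y))
    where
    in-leaf : ∀ y → _≡_ {A = Colour} β α ⊎ (next y ≡ next x × _) →
              SameEdge (ℓ L x) (ℓ L (next x)) (ℓ L y) (ℓ L (next y))
    in-leaf y (inj₁ ())
    in-leaf y (inj₂ (e , _)) with refl ← trans (sym (prev-next y)) (trans (cong prev e) (prev-next x)) =
      inj₁ (refl , refl)

  -- The vertex `x` takes the colour of its lost neighbour. The root then has α or β, or, if it is
  -- `x`, a colour of another index than `L`.
  without-ℓq : ∀ L x j → ℓ L x ⟶ q j → ColourableWithout graph (ℓ L x) (q j) (3 + p′)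
  without-ℓq L x j edge = AtLeaf.without-leaf-edge L (x , col j)
    (λ e → at-base edge (pentagon-col x root e))
    (λ y e → contradiction e (col-proper x y))
    (λ y j′ _ e → to-Q y j′ (pentagon-col x y e))
    where
    at-base : ∀ {A : Set} → ℓ L x ⟶ q j → root ≡ x × _≡_ {A = Colour} (col j) (col (index L)) → A
    at-base (inj₁ x≢root) (r≡x , _) = contradiction (sym r≡x) x≢root
    at-base (inj₂ j≢)     (_ , e)   = contradiction (col-injective e) j≢

    to-Q : ∀ y j′ → y ≡ x × _≡_ {A = Colour} (col j) (col j′) →
           SameEdge (ℓ L x) (q j) (ℓ L y) (q j′)
    to-Q y j′ (refl , e) = inj₁ (refl , cong q (sym (col-injective e)))

  -- Once q_{j₁} and q_{j₂} share a colour, the colour of q_{j₂} is a third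
  -- one for all pentagons.
  without-qq : ∀ {j₁ j₂} → j₁ ≢ j₂ → ColourableWithout graph (q j₁) (q j₂) (3 + p′)
  without-qq {j₁} {j₂} j₁≢j₂ = directed f clash
    where
    merge : Fin (suc p′) → Fin (suc p′)
    merge j with j ≟ j₂
    ... | yes _ = j₁
    ... | no  _ = j

    leaf : Leaf → Pentagon × Colour
    leaf L with proj₂ (base L) ≟ cᵢ
    -- A base c has the third colour itself, so its leaves place that colour at u; at other bases,
    -- coloured α or β, the root takes it.
    ... | yes _ = 1F , col j₂
    ... | no  _ = root , col j₂

    f : Vertex → Colour
    f (q j)   = col (merge j)
    f (s i x) = pentagon (cᵢ , col j₂) x
    f (ℓ L x) = pentagon (leaf L) x

    merge-≢ : ∀ j → merge j ≢ j₂
    merge-≢ j e with j ≟ j₂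
    ... | yes _  = j₁≢j₂ e
    ... | no j≢  = j≢ e

    clash : ∀ {x y} → x ⟶ y → f x ≡ f y → SameEdge (q j₁) (q j₂) x y
    clash {q j} {q j′} j≢j′ e with j ≟ j₂ | j′ ≟ j₂ | col-injective e
    ... | yes refl | yes refl | _    = contradiction refl j≢j′
    ... | yes refl | no _     | refl = inj₂ (refl , refl)
    ... | no _     | yes refl | refl = inj₁ (refl , refl)
    ... | no _     | no _     | e′   = contradiction e′ j≢j′
    clash {s i x} {s _ _} (inj₁ (refl , refl)) e = contradiction e (col-proper cᵢ x)
    clash {s _ _} {s _ _} (inj₂ (_ , refl , refl)) ()
    clash {s i x} {ℓ L _} (b , refl) e with proj₂ (base L) ≟ cᵢ
    clash {s i x} {ℓ L _} (refl , refl) e | yes x≡c rewrite x≡c with () ← e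
    clash {s i x} {ℓ L _} (b , refl) e | no x≢c with pentagon-col cᵢ x e
    ... | refl , _ = contradiction (cong proj₂ b) x≢c
    clash {ℓ L x} {ℓ _ _} (refl , refl) e with proj₂ (base L) ≟ cᵢ
    ... | yes _ = contradiction e (col-proper 1F x)
    ... | no  _ = contradiction e (col-proper root x)
    clash {ℓ L x} {q j} _ e with proj₂ (base L) ≟ cᵢ
    ... | yes _ = contradiction (sym (col-injective (proj₂ (pentagon-col 1F x e)))) (merge-≢ j)
    ... | no  _ = contradiction (sym (col-injective (proj₂ (pentagon-col root x e)))) (merge-≢ j)

  without-⟶ : ∀ {x y} → x ⟶ y → ColourableWithout graph x y (3 + p′)
  without-⟶ {q _}   {q _}   j≢j′                     = without-qq j≢j′
  without-⟶ {s i x} {s _ _} (inj₁ (refl , refl))     = without-ss i x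
  without-⟶ {s _ _} {s _ _} (inj₂ (e , refl , refl)) = without-ca e
  without-⟶ {s _ _} {ℓ L _} (b , refl)               = without-sℓ L b
  without-⟶ {ℓ L x} {ℓ _ _} (refl , refl)            = without-ℓℓ L x
  without-⟶ {ℓ L x} {q j}   edge                     = without-ℓq L x j edge

  without : ∀ {x y} → x ~ y → ColourableWithout graph x y (3 + p′)
  without (inj₁ x⟶y) = without-⟶ x⟶y
  without (inj₂ y⟶x) with f , only ← without-⟶ y⟶x = f , λ x~y e → swap (only x~y e)

  neighbour : ∀ x → ∃[ y ] x ~ y
  neighbour (q j)   = ℓ (at-b zero zero) 1F , inj₂ (inj₁ λ ())
  neighbour (s i x) = s i (next x) , inj₁ (inj₁ (refl , refl))
  neighbour (ℓ L x) = ℓ L (next x) , inj₁ (refl , refl)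

  graph-critical : Critical (4 + p′) graph
  graph-critical = (k-colouring , lower-bound) , critical {graph} without neighbour
    where
    k-colouring : Colourable _~_ (4 + p′)
    k-colouring = without-edge⇒colourable graph
      (without {q zero} {proj₁ (neighbour (q zero))} (proj₂ (neighbour (q zero))))

    lower-bound : ∀ j → Colourable _~_ j → 4 + p′ ≤ j
    lower-bound j (f , proper) with j <? 4 + p′
    ... | no  j≮k = ≮⇒≥ j≮k
    -- Fewer colours embed into a palette of exactly `3 + p′`.
    ... | yes j<k = Uncolourable.uncolourable p′ m (λ x → inject≤ (f x) (s≤s⁻¹ j<k))
      (λ x~y e → proper x~y (inject≤-injective _ _ _ _ e))

-- Number of vertices and the final assembly

25k∸80 : ∀ n → 25 * (4 + n) ∸ 80 ≡ 20 + 25 * n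
25k∸80 n = trans (cong (_∸ 80) (*-distribˡ-+ 25 4 n)) (m+n∸m≡n 80 (20 + 25 * n))

26k∸73 : ∀ n → 26 * (4 + n) ∸ 73 ≡ 31 + 26 * n
26k∸73 n = trans (cong (_∸ 73) (*-distribˡ-+ 26 4 n)) (m+n∸m≡n 73 (31 + 26 * n))

order-H₄ : ∀ n m → order (H (4 + n) m) ≡ (25 * (4 + n) ∸ 80) * m + (26 * (4 + n) ∸ 73)
order-H₄ n m = begin
  order (H (4 + n) m)
    ≡⟨⟩
  -- The clique Q, the pentagons Sᵢ, then five vertices per leaf, with leaves summed by constructor.
  1 + n + ((1 + m) * 5 + ((1 + m) * (1 + n) + ((1 + m) * (1 + n) + ((1 + m) * (1 + n)
    + (1 + n + (1 + n + (m * n + m * n)))))) * 5)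
    ≡⟨ solve 2 (λ n m → con 1 :+ n :+ ((con 1 :+ m) :* con 5 :+
         ((con 1 :+ m) :* (con 1 :+ n) :+ ((con 1 :+ m) :* (con 1 :+ n) :+ ((con 1 :+ m) :* (con 1 :+ n)
         :+ (con 1 :+ n :+ (con 1 :+ n :+ (m :* n :+ m :* n)))))) :* con 5)
         := (con 20 :+ con 25 :* n) :* m :+ (con 31 :+ con 26 :* n)) refl n m ⟩
  (20 + 25 * n) * m + (31 + 26 * n)
    ≡⟨ cong₂ (λ x y → x * m + y) (25k∸80 n) (26k∸73 n) ⟨
  (25 * (4 + n) ∸ 80) * m + (26 * (4 + n) ∸ 73) ∎
  where
  open ≡-Reasoning
  open +-*-Solver using (solve; con; _:+_; _:*_; _:=_)

↔⇒size≡ : ∀ {A B} (finA : Finite A) (finB : Finite B) → A ↔ B → proj₁ finA ≡ proj₁ finB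
↔⇒size≡ (_ , f) (_ , g) e = cantor-schröder-bernstein
  (Injection.injective (↔⇒↣ h)) (Injection.injective (↔⇒↣ (↔-sym h)))
  where h = ↔-trans (↔-sym f) (↔-trans e g)

-- A variable `p` in place of `k ∸ 3` allows matching on `3 + p ≡ k`.
construction-critical : ∀ {k p} m → 1 ≤ p → 3 + p ≡ k → Critical k (Construction.graph p m)
construction-critical m (s≤s z≤n) refl = EdgeRemoval.graph-critical _ m

H-critical : ∀ k m → 4 ≤ k → Critical k (H k m)
H-critical k m 4≤k = construction-critical m (m<n⇒0<n∸m 4≤k) (m+[n∸m]≡n (<⇒≤ 4≤k))

H-chords : ∀ k m → 4 ≤ k → (Z : Cycle (H k m)) →
  Cycle.#chords Z ≤ (k ∸ 3) C 2 + 10 * (k ∸ 3) ^ 2 + 60 * (k ∸ 3)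
H-chords k m 4≤k Z = Chords.#chords-bound (k ∸ 3) m Z (m<n⇒0<n∸m 4≤k)

order-H : ∀ k m → 4 ≤ k → order (H k m) ≡ (25 * k ∸ 80) * m + (26 * k ∸ 73)
order-H (suc (suc (suc (suc n)))) m (s≤s (s≤s (s≤s (s≤s z≤n)))) = order-H₄ n m

-- Isomorphic graphs have equal order, and the order is linear in `m` with positive slope
-- `20 + 25 * n`.
H-≅-injective : ∀ k {i j} → 4 ≤ k → H k i ≅ H k j → i ≡ j
H-≅-injective k@(suc (suc (suc (suc n)))) {i} {j} 4≤k@(s≤s (s≤s (s≤s (s≤s z≤n)))) (φ , _) =
  *-cancelˡ-≡ i j (20 + 25 * n) (subst (λ c → c * i ≡ c * j) (25k∸80 n)
    (+-cancelʳ-≡ (26 * k ∸ 73) _ _ (trans (sym (order-H k i 4≤k)) (trans order≡ (order-H k j 4≤k)))))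
  where
  order≡ = ↔⇒size≡ (Graph.finite (H k i)) (Graph.finite (H k j)) φ

theorem1p6 : (∀ (k : ℕ) → 4 ≤ k →
    Σ[ c ∈ ℕ ] InfinitelyMany
    (λ G → Critical k G × (∀ (Z : Cycle G) → Cycle.#chords Z ≤ c)))
    ×
    (∀ (k m : ℕ) → 4 ≤ k → 1 ≤ m →
    Critical k (H k m)
    × order (H k m) ≡ (25 * k ∸ 80) * m + (26 * k ∸ 73)
    × (∀ (Z : Cycle (H k m)) →
    Cycle.#chords Z ≤ ((k ∸ 3) C 2) + 10 * (k ∸ 3) ^ 2 + 60 * (k ∸ 3)))
theorem1p6 =
    -- The inferred constant is the chord bound, which mentions `k` but not `m`.
    (λ k 4≤k → _ , H k , (λ m → H-critical k m 4≤k , H-chords k m 4≤k)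
                       , λ i j i≢j iso → i≢j (H-≅-injective k 4≤k iso))
  , (λ k m 4≤k _ → H-critical k m 4≤k , order-H k m 4≤k , H-chords k m 4≤k)
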